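{- In pull-based broadcast scheduling: (i) with unit-sized pages, for every $\epsilon>0$ there is an online algorithm which, run on a server of speed $1+\epsilon$, achieves maximum delay factor at most $O(1/\epsilon^2)$ times the optimal maximum delay factor of an offline schedule on a speed-$1$ server; (ii) with pages of different sizes, for every $\epsilon>0$ there is an online algorithm which, on a server of speed $2+\epsilon$, achieves maximum delay factor at most $O(1/\epsilon^2)$ times the optimal offline (speed-$1$) maximum delay factor. The same bounds (speed $1+\epsilon$ for unit-sized pages and $2+\epsilon$ for different sized pages, competitive ratio $O(1/\epsilon^2)$) hold for minimizing the maximum weighted response time and for minimizing the maximum weighted delay factor.
   Context: Broadcast scheduling: pages $p$ with lengths $\ell_p$ (time needed to transmit $p$ at speed $1$; a speed-$s$ server needs $\ell_p/s$). Requests arrive online; request $J_{p,i}$ for page $p$ arrives at time $a_{p,i}$, has a deadline $d_{p,i}$, slack $S_{p,i}=d_{p,i}-a_{p,i}$, and (for the weighted objectives) a weight $w_{p,i}\ge 0$. A transmission of $p$ satisfies all requests for $p$ that arrived before it started; requests must receive the page sequentially from its beginning, so a request arriving during a transmission of $p$ is not satisfied by it (with different sized pages, transmissions may be preempted). The finish time $f_{p,i}$ is the completion time of the first transmission of $p$ that satisfies $J_{p,i}$. Delay factor of $J_{p,i}$: $\max\{1,(f_{p,i}-a_{p,i})/S_{p,i}\}$; weighted response time: $w_{p,i}(f_{p,i}-a_{p,i})$; weighted delay factor: $w_{p,i}\max\{1,(f_{p,i}-a_{p,i})/S_{p,i}\}$. The objectives are the maxima of these quantities over all requests. An online algorithm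 with speed $s$ is $c$-competitive if on every request sequence its objective value is at most $c$ times the optimal value of an offline schedule using a speed-$1$ server.
   Formalization: Arrival times, deadlines, weights, page lengths, ε and the times in schedules are rational instead of real; O(1/ε²) is read as one constant C with ratio C/ε² for all 0 < ε ≤ 1. -}

module Defs where

open import Data.Nat using (ℕ)
open import Data.Product using (Σ; ∃; ∃-syntax; _×_; _,_)
open import Data.Sum using (_⊎_)
open import Data.Maybe using (Maybe; just; nothing)
open import Data.List using (List; []; _∷_; filter)
open import Data.List.Membership.Propositional using (_∈_)
open import Data.List.Relation.Unary.AllPairs using (AllPairs)
open import Relation.Binary.PropositionalEquality using (_≡_; _≢_; subst)
open import Relation.Nullary using (yes; no; ¬_)
open import Data.Nat using () renaming (_≟_ to _≟ℕ_)
open import Data.Rational using (ℚ; 0ℚ; 1ℚ; _+_; _-_; _*_; _÷_; _⊔_; _≤_; _<_; -_; Positive; NonZero; positive)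
open import Data.Rational.Properties using (_≤?_; _<?_; pos⇒nonZero; +-monoˡ-<; +-inverseʳ)

-- Requests.  Times, deadlines, weights are rationals.  The slack
-- d - a is required to be positive and the weight non-negative; these
-- proofs are irrelevant fields, so two requests with the same data are
-- definitionally equal.

record Request : Set where
  field
    page : ℕ
    arr  : ℚ
    dl   : ℚ
    wt   : ℚ
    .slack-pos : arr < dl
    .wt-nonneg : 0ℚ ≤ wt
open Request public

Instance : Set
Instance = List Request

0<q-p : ∀ {p q : ℚ} → p < q → 0ℚ < q - p
0<q-p {p} {q} p<q = subst (_< q - p) (+-inverseʳ p) (+-monoˡ-< (- p) p<q)

slack : Request → ℚ
slack J = dl J - arr J

.slack-nonZero : (J : Request) → NonZero (slack J)
slack-nonZero J@record { slack-pos = sp } = pos⇒nonZero (slack J) {{positive (0<q-p sp)}}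

-- Schedules.  A schedule is a finite list of pieces: during [st , en)
-- the server broadcasts page pg as part of transmission number tid.
-- A transmission is the (finite) set of pieces sharing a tid; it may
-- be preempted and resumed (several pieces), and it starts from the
-- beginning of the page.

record Piece : Set where
  field
    pg  : ℕ
    tid : ℕ
    st  : ℚ
    en  : ℚ
open Piece public

Schedule : Set
Schedule = List Piece

dur : Schedule → ℕ → ℚ
dur [] k = 0ℚ
dur (x ∷ S) k with tid x ≟ℕ k
... | yes _ = (en x - st x) + dur S k
... | no  _ = dur S k

Lengths : Set
Lengths = ℕ → ℚ

PositiveLengths : Lengths → Set
PositiveLengths ℓ = ∀ p → 0ℚ < ℓ p

UnitLengths : Lengths → Set
UnitLengths ℓ = ∀ p → ℓ p ≡ 1ℚ

-- a valid schedule for a server of speed s: pieces are non-empty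
-- intervals, no two pieces overlap (one server), all pieces of a
-- transmission carry the same page, and no transmission transmits more
-- than the page (it needs ℓ p / s time; aborted transmissions allowed).
Valid : ℚ → Lengths → Schedule → Set
Valid s ℓ S =
    (∀ {x} → x ∈ S → st x < en x)
  × AllPairs (λ x y → en x ≤ st y ⊎ en y ≤ st x) S
  × (∀ {x y} → x ∈ S → y ∈ S → tid x ≡ tid y → pg x ≡ pg y)
  × (∀ {x} → x ∈ S → s * dur S (tid x) ≤ ℓ (pg x))

NonPreemptive : ℚ → Lengths → Schedule → Set
NonPreemptive s ℓ S =
    AllPairs (λ x y → tid x ≢ tid y) S
  × (∀ {x} → x ∈ S → s * (en x - st x) ≡ ℓ (pg x))

-- In S (speed s), request J is satisfied by some complete transmission
-- of its page that started no earlier than its arrival and that is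
-- finished by time f.  (So the finish time f_J of J is ≤ f.)
FinishedBy : ℚ → Lengths → Schedule → Request → ℚ → Set
FinishedBy s ℓ S J f = ∃[ k ]
    (s * dur S k ≡ ℓ (page J))
  × (∀ {x} → x ∈ S → tid x ≡ k → (pg x ≡ page J) × (arr J ≤ st x) × (en x ≤ f))

data Objective : Set where
  delayFactor         : Objective
  weightedResponse    : Objective
  weightedDelayFactor : Objective

cost : Objective → Request → ℚ → ℚ
cost delayFactor J f =
  1ℚ ⊔ ((f - arr J) ÷ slack J) {{slack-nonZero J}}
cost weightedResponse J f = wt J * (f - arr J)
cost weightedDelayFactor J f =
  wt J * (1ℚ ⊔ ((f - arr J) ÷ slack J) {{slack-nonZero J}})

ObjAtMost : Objective → ℚ → Lengths → Instance → Schedule → ℚ → Set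
ObjAtMost obj s ℓ I S B =
  ∀ {J} → J ∈ I → ∃[ f ] (FinishedBy s ℓ S J f × cost obj J f ≤ B)

activeAt : Schedule → ℚ → Maybe (ℕ × ℕ)
activeAt [] τ = nothing
activeAt (x ∷ S) τ with st x ≤? τ | τ <? en x
... | yes _ | yes _ = just (pg x , tid x)
... | _     | _     = activeAt S τ

arrivedBy : ℚ → Instance → Instance
arrivedBy τ I = filter (λ J → arr J ≤? τ) I

Algorithm : Set
Algorithm = Instance → Schedule

Online : Algorithm → Set
Online A = ∀ (I I′ : Instance) (τ : ℚ) →
  arrivedBy τ I ≡ arrivedBy τ I′ → activeAt (A I) τ ≡ activeAt (A I′) τ

-- A (speed s, page lengths ℓ) is competitive with ratio C/ε² against all
-- speed-1 offline schedules, for objective obj.  `np` says whether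
-- schedules must be non-preemptive.  OPT ≤ B ⇒ ALG ≤ (C/ε²)·B, written
-- as ε·ε·ALG ≤ C·B.
data Mode : Set where
  nonPreemptive preemptive : Mode

Allowed : Mode → ℚ → Lengths → Schedule → Set
Allowed nonPreemptive s ℓ S = Valid s ℓ S × NonPreemptive s ℓ S
Allowed preemptive    s ℓ S = Valid s ℓ S

Competitive : Mode → Objective → ℚ → Lengths → ℚ → ℚ → Algorithm → Set
Competitive m obj s ℓ C ε A = ∀ (I : Instance) →
    Allowed m s ℓ (A I)
  × (∀ (B : ℚ) (S : Schedule) → Allowed m 1ℚ ℓ S → ObjAtMost obj 1ℚ ℓ I S B →
       ∀ {J} → J ∈ I → ∃[ f ] (FinishedBy s ℓ (A I) J f × ε * ε * cost obj J f ≤ C * B))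

{-# OPTIONS --safe #-}

-- All three objectives amount to a weighted response time v_J (f_J - a_J).
-- Among the pending requests the server considers those whose weighted wait
-- is at least ε/6 of the largest one and works on one of maximal v, deciding
-- anew after a transmission (unit pages), or after a completion, an arrival or
-- a delay of at most the shortest pending page (arbitrary pages).
--
-- Let B bound the objective of the offline schedule S, and suppose that a
-- request J with weight θ waits long.  From some time t₀ on, with
-- ε θ (t₀ - a_J) ≤ 7B, the server works only for requests of weight at least
-- θ whose weighted wait is at least B, so that S has already finished them;
-- these requests also arrived at most 7B/(εθ) before t₀.  Two transmissions of
-- one page started after t₀ are charged to different transmissions of S, for
-- the second one is needed by a request that arrived after the first began.
-- Moreover each page has at most one transmission started before and continued
-- after t₀.  Hence both kinds separately fit into the interval from
-- t₀ - 7B/(εθ) to now, and the second kind is absent for unit pages.  With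
-- speed 1+ε, respectively 2+ε, this gives ε (now - t₀) ≤ 14B/(εθ), and so
-- ε² θ (now - a_J) ≤ 21B ≤ 36B.
module Submission where

open import Defs
open import Data.Product using (Σ; ∃; ∃-syntax; _×_; _,_)
open import Data.Rational using (ℚ; 0ℚ; 1ℚ; _+_; _≤_; _<_)

open import Data.Rational.Properties
open import Data.Bool using (T)
open import Data.Empty using (⊥-elim)
import Data.Integer as ℤ
import Data.Integer.Properties as ℤₚ
open import Data.List using (List; []; _∷_; filter; map; mapMaybe)
open import Relation.Binary.Bundles using (DecTotalOrder)
open import Data.List.Extrema (DecTotalOrder.totalOrder ≤-decTotalOrder)
  using (argmax; argmax-sel; f[⊥]≤f[argmax]; f[xs]≤f[argmax]; min; min≤⊤; min≤xs; argmin-sel)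
open import Data.List.Membership.Propositional using (_∈_; _∉_)
open import Data.List.Membership.Propositional.Properties using (∈-filter⁺; ∈-filter⁻; ∈-map⁺; ∈-map⁻)
open import Data.List.Properties using (filter-accept; filter-reject)
open import Data.List.Relation.Unary.All as All using (All; []; _∷_; all?)
open import Data.List.Relation.Unary.AllPairs using (AllPairs; []; _∷_)
open import Data.List.Relation.Unary.Any using (here; there)
open import Data.List.Relation.Unary.Unique.Propositional using (Unique)
open import Data.Maybe using (Maybe; just; nothing; is-just; maybe′)
import Data.Nat as Nat
open import Data.Nat using (ℕ; suc) renaming (_≟_ to _≟ℕ_; _<_ to _<ℕ_; _≤_ to _≤ℕ_)
import Data.Nat.Coprimality as Coprime
import Data.Nat.Properties as ℕₚ
open import Data.List.Membership.DecPropositional _≟ℕ_ using (_∈?_)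
open import Data.Product using (proj₁; proj₂)
open import Data.Rational using (mkℚ; *≤*; _-_; _*_; -_; 1/_; _/_; _⊔_; NonZero; positive; nonNegative)
import Data.Rational.Unnormalised as ℚᵘ
import Data.Rational.Unnormalised.Properties as ℚᵘₚ
open import Data.Sum using (_⊎_; inj₁; inj₂)
open import Data.Unit using (tt)
open import Function using (_∘_; id)
open import Relation.Binary.PropositionalEquality
open import Relation.Nullary using (Dec; yes; no; ¬_; contradiction; recompute; _×-dec_)
open import Relation.Nullary.Decidable using (T?; dec⇒maybe)
open import Relation.Unary using (Decidable)
open import Tactic.RingSolver using (solve-∀)
open import Tactic.RingSolver.Core.AlmostCommutativeRing using (AlmostCommutativeRing; fromCommutativeRing)

-- The server cannot know B, so its threshold is relative to the largest current weighted wait.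
-- Induction on the steps makes it absolute: `Good` carries the bound `Response`, that is ε²·wait ≤
-- 36B, for all pending requests. Given this bound, a request with ε·wait ≥ 6B passes the relative
-- test, so the chosen request has at least its weight and a weighted wait of at least B. One
-- constant 6 occurs in the urgency test, in `D` = 6B and in `Response` (6D); it closes the
-- induction because B ≤ D gives 3(D + B) ≤ 6D. Which weight θ matters is known only when a late
-- request is served. Therefore `Good` keeps a segment for every positive θ and restarts it whenever
-- the server works for a lighter request or for one whose weighted wait is below B. The B added to
-- D is the growth of a weighted wait during one decision: a decision lasts no longer than the page
-- length ℓ of any request pending in it, and v·ℓ ≤ B because S needs time ℓ for that page.

ℚ-ring : AlmostCommutativeRing _ _
ℚ-ring = fromCommutativeRing +-*-commutativeRing (λ x → dec⇒maybe (0ℚ ≟ x))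

-- Order arithmetic of rationals and finite sums.

p+[q-p]≡q : ∀ p q → p + (q - p) ≡ q
p+[q-p]≡q = solve-∀ ℚ-ring

-- Trades an inequality for a nonnegative witness of the difference, whose equation the ring solver
-- can check.
≤-diff : ∀ {p q} d → 0ℚ ≤ d → d ≡ q - p → p ≤ q
≤-diff {p} {q} d 0≤d d≡ =
  subst₂ _≤_ (+-identityʳ p) (trans (cong (p +_) d≡) (p+[q-p]≡q p q)) (+-monoʳ-≤ p 0≤d)

0≤diff : ∀ {p q} → p ≤ q → 0ℚ ≤ q - p
0≤diff {p} {q} p≤q = subst (_≤ q - p) (+-inverseʳ p) (+-monoˡ-≤ (- p) p≤q)

0≤+ : ∀ {p q} → 0ℚ ≤ p → 0ℚ ≤ q → 0ℚ ≤ p + q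
0≤+ 0≤p 0≤q = +-mono-≤ 0≤p 0≤q

0≤* : ∀ {p q} → 0ℚ ≤ p → 0ℚ ≤ q → 0ℚ ≤ p * q
0≤* {p} {q} 0≤p 0≤q = subst (_≤ p * q) (*-zeroʳ p) (*-monoˡ-≤-nonNeg p {{nonNegative 0≤p}} 0≤q)

0<* : ∀ {p q} → 0ℚ < p → 0ℚ < q → 0ℚ < p * q
0<* {p} {q} 0<p 0<q = subst (_< p * q) (*-zeroʳ p) (*-monoʳ-<-pos p {{positive 0<p}} 0<q)

*-monoˡ : ∀ {r p q} → 0ℚ ≤ r → p ≤ q → r * p ≤ r * q
*-monoˡ {r} 0≤r p≤q = *-monoˡ-≤-nonNeg r {{nonNegative 0≤r}} p≤q

*-cancelˡ : ∀ {r p q} → 0ℚ < r → r * p ≤ r * q → p ≤ q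
*-cancelˡ {r} 0<r h = *-cancelˡ-≤-pos r {{positive 0<r}} h

*-nonpos : ∀ {p q} → 0ℚ ≤ p → q ≤ 0ℚ → p * q ≤ 0ℚ
*-nonpos {p} {q} 0≤p q≤0 = subst (p * q ≤_) (*-zeroʳ p) (*-monoˡ 0≤p q≤0)

<⊎≥ : ∀ p q → p < q ⊎ q ≤ p
<⊎≥ p q with p <? q
... | yes p<q = inj₁ p<q
... | no  p≮q = inj₂ (≮⇒≥ p≮q)

∑ : {A : Set} → (A → ℚ) → List A → ℚ
∑ f []       = 0ℚ
∑ f (x ∷ xs) = f x + ∑ f xs

∑-mono : {A : Set} {f g : A → ℚ} (xs : List A) → (∀ {x} → x ∈ xs → f x ≤ g x) → ∑ f xs ≤ ∑ g xs
∑-mono []       h = ≤-refl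
∑-mono (x ∷ xs) h = +-mono-≤ (h (here refl)) (∑-mono xs (h ∘ there))

∑-nonneg : {A : Set} {f : A → ℚ} (xs : List A) → (∀ {x} → x ∈ xs → 0ℚ ≤ f x) → 0ℚ ≤ ∑ f xs
∑-nonneg []       h = ≤-refl
∑-nonneg (x ∷ xs) h = 0≤+ (h (here refl)) (∑-nonneg xs (h ∘ there))

∑-*ˡ : {A : Set} (c : ℚ) (f : A → ℚ) (xs : List A) → ∑ (λ x → c * f x) xs ≡ c * ∑ f xs
∑-*ˡ c f []       = sym (*-zeroʳ c)
∑-*ˡ c f (x ∷ xs) = trans (cong (c * f x +_) (∑-*ˡ c f xs)) (sym (*-distribˡ-+ c (f x) (∑ f xs)))

∑-map : {A B : Set} (f : B → ℚ) (g : A → B) (xs : List A) → ∑ f (map g xs) ≡ ∑ (f ∘ g) xs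
∑-map f g []       = refl
∑-map f g (x ∷ xs) = cong (f (g x) +_) (∑-map f g xs)

-- Disjoint pieces inside an interval

len : Piece → ℚ
len x = en x - st x

Proper : Schedule → Set
Proper S = ∀ {x} → x ∈ S → st x < en x

Disjoint : Piece → Piece → Set
Disjoint x y = en x ≤ st y ⊎ en y ≤ st x

0≤len : ∀ {x} → st x < en x → 0ℚ ≤ len x
0≤len p = 0≤diff (<⇒≤ p)

dur-same : ∀ x S {k} → tid x ≡ k → dur (x ∷ S) k ≡ len x + dur S k
dur-same x S {k} eq with tid x ≟ℕ k
... | yes _ = refl
... | no ¬p = contradiction eq ¬p

dur-other : ∀ x S {k} → tid x ≢ k → dur (x ∷ S) k ≡ dur S k
dur-other x S {k} neq with tid x ≟ℕ k
... | yes p = contradiction p neq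
... | no _  = refl

dur-absent : ∀ S k → (∀ {x} → x ∈ S → tid x ≢ k) → dur S k ≡ 0ℚ
dur-absent []      k h = refl
dur-absent (x ∷ S) k h = trans (dur-other x S (h (here refl))) (dur-absent S k (h ∘ there))

dur-present : ∀ S k → 0ℚ < dur S k → ∃[ x ] (x ∈ S × tid x ≡ k)
dur-present []      k 0<d = ⊥-elim (<-irrefl refl 0<d)
dur-present (x ∷ S) k 0<d with tid x ≟ℕ k
... | yes p = x , here refl , p
... | no _  with dur-present S k 0<d
...   | y , y∈ , eq = y , there y∈ , eq

dur-nonneg : ∀ S k → Proper S → 0ℚ ≤ dur S k
dur-nonneg []      k h = ≤-refl
dur-nonneg (x ∷ S) k h with tid x ≟ℕ k
... | yes _ = 0≤+ (0≤len {x} (h (here refl))) (dur-nonneg S k (h ∘ there))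
... | no _  = dur-nonneg S k (h ∘ there)

dur-∷ : ∀ x S k → st x < en x → dur S k ≤ dur (x ∷ S) k
dur-∷ x S k p with tid x ≟ℕ k
... | yes _ = ≤-diff (len x) (0≤len {x} p) (lemma (len x) (dur S k))
  where
  lemma : ∀ a b → a ≡ (a + b) - b
  lemma = solve-∀ ℚ-ring
... | no _  = ≤-refl

-- Pieces that are not fully inside count zero instead of being filtered out, so the interval can
-- vary during an induction on the list.
within : ℚ → ℚ → Piece → ℚ
within a b x with a ≤? st x | en x ≤? b
... | yes _ | yes _ = len x
... | yes _ | no _  = 0ℚ
... | no _  | _     = 0ℚ

within-nonneg : ∀ a b x → st x < en x → 0ℚ ≤ within a b x
within-nonneg a b x p with a ≤? st x | en x ≤? b
... | yes _ | yes _ = 0≤len {x} p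
... | yes _ | no _  = ≤-refl
... | no _  | _     = ≤-refl

within-≡ : ∀ a b x → a ≤ st x → en x ≤ b → within a b x ≡ len x
within-≡ a b x p q with a ≤? st x | en x ≤? b
... | yes _ | yes _ = refl
... | yes _ | no ¬q = contradiction q ¬q
... | no ¬p | _     = contradiction p ¬p

within-cases : ∀ a b x → (a ≤ st x × en x ≤ b) ⊎ within a b x ≡ 0ℚ
within-cases a b x with a ≤? st x | en x ≤? b
... | yes p | yes q = inj₁ (p , q)
... | yes _ | no _  = inj₂ refl
... | no _  | _     = inj₂ refl

within-split : ∀ a b x y → st y < en y → Disjoint x y →
  within a b y ≤ within a (st x) y + within (en x) b y
within-split a b x y p d with within-cases a b y | d
... | inj₂ eq | _ = ≤-trans (≤-reflexive eq)
  (0≤+ (within-nonneg a (st x) y p) (within-nonneg (en x) b y p))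
... | inj₁ (a≤ , ≤b) | inj₂ ey≤sx = begin
  within a b y ≡⟨ within-≡ a b y a≤ ≤b ⟩
  len y ≡⟨ within-≡ a (st x) y a≤ ey≤sx ⟨
  within a (st x) y ≡⟨ +-identityʳ _ ⟨
  within a (st x) y + 0ℚ ≤⟨ +-monoʳ-≤ (within a (st x) y) (within-nonneg (en x) b y p) ⟩
  within a (st x) y + within (en x) b y ∎
  where open ≤-Reasoning
... | inj₁ (a≤ , ≤b) | inj₁ ex≤sy = begin
  within a b y ≡⟨ within-≡ a b y a≤ ≤b ⟩
  len y ≡⟨ within-≡ (en x) b y ex≤sy ≤b ⟨
  within (en x) b y ≡⟨ +-identityˡ _ ⟨
  0ℚ + within (en x) b y ≤⟨ +-monoˡ-≤ (within (en x) b y) (within-nonneg a (st x) y p) ⟩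
  within a (st x) y + within (en x) b y ∎
  where open ≤-Reasoning

∑within-split : ∀ a b x S → Proper S → All (Disjoint x) S →
  ∑ (within a b) S ≤ ∑ (within a (st x)) S + ∑ (within (en x) b) S
∑within-split a b x []      h []       = ≤-refl
∑within-split a b x (y ∷ S) h (d ∷ ds) =
  ≤-trans (+-mono-≤ (within-split a b x y (h (here refl)) d) (∑within-split a b x S (h ∘ there) ds))
          (≤-reflexive (lemma (within a (st x) y) (within (en x) b y)
                              (∑ (within a (st x)) S) (∑ (within (en x) b) S)))
  where
  lemma : ∀ p q r s → (p + q) + (r + s) ≡ (p + r) + (q + s)
  lemma = solve-∀ ℚ-ring

-- The head piece, if inside, cuts the interval in two. By disjointness every other piece that
-- counts lies on one side, and the induction hypothesis is used for both sides.
∑within≤ : ∀ S → Proper S → AllPairs Disjoint S → ∀ {a b} → a ≤ b → ∑ (within a b) S ≤ b - a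
∑within≤ []      h []       a≤b = 0≤diff a≤b
∑within≤ (x ∷ S) h (d ∷ ds) {a} {b} a≤b with within-cases a b x
... | inj₂ eq = ≤-trans (≤-reflexive (trans (cong (_+ ∑ (within a b) S) eq) (+-identityˡ _)))
                        (∑within≤ S (h ∘ there) ds a≤b)
... | inj₁ (a≤ , ≤b) = begin
  within a b x + ∑ (within a b) S
    ≡⟨ cong (_+ ∑ (within a b) S) (within-≡ a b x a≤ ≤b) ⟩
  len x + ∑ (within a b) S
    ≤⟨ +-monoʳ-≤ (len x) (∑within-split a b x S (h ∘ there) d) ⟩
  len x + (∑ (within a (st x)) S + ∑ (within (en x) b) S)
    ≤⟨ +-monoʳ-≤ (len x) (+-mono-≤ (∑within≤ S (h ∘ there) ds a≤) (∑within≤ S (h ∘ there) ds ≤b)) ⟩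
  len x + ((st x - a) + (b - en x))
    ≡⟨ lemma (en x) (st x) a b ⟩
  b - a ∎
  where
  open ≤-Reasoning
  lemma : ∀ e s a b → (e - s) + ((s - a) + (b - e)) ≡ b - a
  lemma = solve-∀ ℚ-ring

∑dur-absent : ∀ x S ks → tid x ∉ ks → ∑ (dur (x ∷ S)) ks ≡ ∑ (dur S) ks
∑dur-absent x S []       h = refl
∑dur-absent x S (k ∷ ks) h = cong₂ _+_ (dur-other x S (h ∘ here)) (∑dur-absent x S ks (h ∘ there))

∑dur-∷ : ∀ x S ks {w} → 0ℚ ≤ w → Unique ks → (tid x ∈ ks → len x ≤ w) →
  ∑ (dur (x ∷ S)) ks ≤ w + ∑ (dur S) ks
∑dur-∷ x S []       0≤w []        h = ≤-trans 0≤w (≤-reflexive (sym (+-identityʳ _)))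
∑dur-∷ x S (k ∷ ks) {w} 0≤w (k∉ ∷ u) h with tid x ≟ℕ k
... | yes refl = begin
  len x + dur S k + ∑ (dur (x ∷ S)) ks ≡⟨ cong (len x + dur S k +_) (∑dur-absent x S ks λ k∈ → All.lookup k∉ k∈ refl) ⟩
  len x + dur S k + ∑ (dur S) ks       ≡⟨ +-assoc (len x) _ _ ⟩
  len x + (dur S k + ∑ (dur S) ks)     ≤⟨ +-monoˡ-≤ _ (h (here refl)) ⟩
  w + (dur S k + ∑ (dur S) ks) ∎
  where open ≤-Reasoning
... | no neq = begin
  dur S k + ∑ (dur (x ∷ S)) ks   ≤⟨ +-monoʳ-≤ (dur S k) (∑dur-∷ x S ks 0≤w u (h ∘ there)) ⟩
  dur S k + (w + ∑ (dur S) ks)   ≡⟨ lemma (dur S k) w (∑ (dur S) ks) ⟩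
  w + (dur S k + ∑ (dur S) ks) ∎
  where
  open ≤-Reasoning
  lemma : ∀ a b c → a + (b + c) ≡ b + (a + c)
  lemma = solve-∀ ℚ-ring

∑dur≤∑within : ∀ S ks a b → Proper S → Unique ks →
  (∀ {x} → x ∈ S → tid x ∈ ks → a ≤ st x × en x ≤ b) → ∑ (dur S) ks ≤ ∑ (within a b) S
∑dur≤∑within []      ks a b h u w = ≤-reflexive (zeros ks)
  where
  zeros : ∀ ks → ∑ (dur []) ks ≡ 0ℚ
  zeros []       = refl
  zeros (k ∷ ks) = trans (+-identityˡ _) (zeros ks)
∑dur≤∑within (x ∷ S) ks a b h u w = ≤-trans
  (∑dur-∷ x S ks (within-nonneg a b x (h (here refl))) u
    λ k∈ → ≤-reflexive (sym (within-≡ a b x (proj₁ (w (here refl) k∈)) (proj₂ (w (here refl) k∈)))))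
  (+-monoʳ-≤ (within a b x) (∑dur≤∑within S ks a b (h ∘ there) u (w ∘ there)))

-- Applied to the offline schedule: `ks` will be the transmissions charged during a segment, or the
-- single one that serves a request.
volume : ∀ S ks {a b} → Proper S → AllPairs Disjoint S → Unique ks → a ≤ b →
  (∀ {x} → x ∈ S → tid x ∈ ks → a ≤ st x × en x ≤ b) → ∑ (dur S) ks ≤ b - a
volume S ks {a} {b} h d u a≤b w = ≤-trans (∑dur≤∑within S ks a b h u w) (∑within≤ S h d a≤b)

∑dur-mono-∷ : ∀ x S ks → st x < en x → ∑ (dur S) ks ≤ ∑ (dur (x ∷ S)) ks
∑dur-mono-∷ x S ks p = ∑-mono ks (λ {k} _ → dur-∷ x S k p)

∑dur-∷-∈ : ∀ x S ks → st x < en x → tid x ∈ ks → len x + ∑ (dur S) ks ≤ ∑ (dur (x ∷ S)) ks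
∑dur-∷-∈ x S (k ∷ ks) p (here refl) =
  ≤-trans (≤-reflexive (sym (+-assoc (len x) _ _)))
          (+-mono-≤ (≤-reflexive (sym (dur-same x S refl))) (∑dur-mono-∷ x S ks p))
∑dur-∷-∈ x S (k ∷ ks) p (there k∈) =
  ≤-trans (≤-reflexive (lemma (len x) (dur S k) (∑ (dur S) ks)))
          (+-mono-≤ (dur-∷ x S k p) (∑dur-∷-∈ x S ks p k∈))
  where
  lemma : ∀ a b c → a + (b + c) ≡ b + (a + c)
  lemma = solve-∀ ℚ-ring

-- The algorithm

6ℚ : ℚ
6ℚ = ℤ.+ 6 / 1

0≤6ℚ : 0ℚ ≤ 6ℚ
0≤6ℚ = nonNegative⁻¹ 6ℚ

0≤1ℚ : 0ℚ ≤ 1ℚ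
0≤1ℚ = nonNegative⁻¹ 1ℚ

∈-mapMaybe⁻ : {A B : Set} (f : A → Maybe B) (xs : List A) {y : B} →
  y ∈ mapMaybe f xs → ∃[ x ] (x ∈ xs × f x ≡ just y)
∈-mapMaybe⁻ f (x ∷ xs) y∈ with f x in eq
∈-mapMaybe⁻ f (x ∷ xs) (here refl) | just _  = x , here refl , eq
∈-mapMaybe⁻ f (x ∷ xs) (there y∈)  | just _  =
  let z , z∈ , e = ∈-mapMaybe⁻ f xs y∈ in z , there z∈ , e
∈-mapMaybe⁻ f (x ∷ xs) y∈          | nothing =
  let z , z∈ , e = ∈-mapMaybe⁻ f xs y∈ in z , there z∈ , e

∈-mapMaybe⁺ : {A B : Set} (f : A → Maybe B) {xs : List A} {x : A} {y : B} →
  x ∈ xs → f x ≡ just y → y ∈ mapMaybe f xs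
∈-mapMaybe⁺ f {x ∷ xs} (here refl) e with f x
∈-mapMaybe⁺ f {x ∷ xs} (here refl) refl | just _ = here refl
∈-mapMaybe⁺ f {x ∷ xs} (there x∈) e with f x
... | just _  = there (∈-mapMaybe⁺ f x∈ e)
... | nothing = ∈-mapMaybe⁺ f x∈ e

-- A request together with the transmission that is to satisfy it, if one
-- has been started: its number and the amount of the page still to be sent.
record Item : Set where
  constructor item
  field
    req : Request
    cur : Maybe (ℕ × ℚ)
open Item public

waiting : Request → Item
waiting J = item J nothing

record State : Set where
  constructor state
  field
    now    : ℚ
    next   : ℕ
    items  : List Item
    pieces : Schedule
open State public

arrived : ℚ → List Item → List Item
arrived t = filter (λ it → arr (req it) ≤? t)

Joins : ℚ → Maybe (ℕ × ℚ) → Item → Set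
Joins t nothing  it = arr (req it) ≤ t
Joins t (just _) it = T (is-just (cur it))

joins? : ∀ t m → Decidable (Joins t m)
joins? t nothing  it = arr (req it) ≤? t
joins? t (just _) it = T? (is-just (cur it))

-- The items served while x is: a new transmission takes over all arrived
-- requests for the page, a running one serves those it was started for.
Covered : ℚ → Item → Item → Set
Covered t x it = page (req x) ≡ page (req it) × Joins t (cur x) it

covered? : ∀ t x → Decidable (Covered t x)
covered? t x it = (page (req x) ≟ℕ page (req it)) ×-dec joins? t (cur x) it

module Algorithm (mode : Mode) (s r ε : ℚ) (ℓ : Lengths) (v : Request → ℚ) where

  wait : ℚ → Item → ℚ
  wait t it = v (req it) * (t - arr (req it))

  Urgent : ℚ → List Item → Item → Set
  Urgent t as it = All (λ a → ε * wait t a ≤ 6ℚ * wait t it) as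

  urgent? : ∀ t as → Decidable (Urgent t as)
  urgent? t as it = all? (λ a → ε * wait t a ≤? 6ℚ * wait t it) as

  longest : ℚ → Item → List Item → Item
  longest t = argmax (wait t)

  -- The default of `argmax`, the item with the longest weighted wait, is itself urgent when ε ≤ 6,
  -- so the choice stays among the urgent items.
  pick : ℚ → Item → List Item → Item
  pick t a as = argmax (v ∘ req) (longest t a as) (filter (urgent? t (a ∷ as)) (a ∷ as))

  -- The length is not divided by the speed: it is compared with the time that the offline server
  -- needs for the page.
  boundᵈ : ∀ {P : Set} → Dec P → ℚ → Item → ℚ
  boundᵈ (yes _) t it = t + ℓ (page (req it))
  boundᵈ (no _)  t it = arr (req it)

  bound : ℚ → Item → ℚ
  bound t it = boundᵈ (arr (req it) ≤? t) t it

  stopAt : Mode → ℚ → ℚ → List Item → ℚ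
  stopAt nonPreemptive t w is = t + w * r
  stopAt preemptive    t w is = min (t + w * r) (map (bound t) is)

  transmission : ℕ → Item → ℕ
  transmission n (item J nothing)        = n
  transmission n (item J (just (k , _))) = k

  amount : Item → ℚ
  amount (item J nothing)        = ℓ (page J)
  amount (item J (just (_ , w))) = w

  fresh : ℕ → Item → ℕ
  fresh n (item J nothing)  = suc n
  fresh n (item J (just _)) = n

  settleᵈ : ∀ {P Q : Set} → Dec P → Dec Q → ℕ → ℚ → Item → Maybe Item
  settleᵈ (yes _) (yes _) k w it = nothing
  settleᵈ (yes _) (no _)  k w it = just (item (req it) (just (k , w)))
  settleᵈ (no _)  _       k w it = just it

  settle : ℚ → Item → ℕ → ℚ → Item → Maybe Item
  settle t x k w it = settleᵈ (covered? t x it) (w ≟ 0ℚ) k w it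

  stop : State → Item → ℚ
  stop σ x = stopAt mode (now σ) (amount x) (items σ)

  left : State → Item → ℚ
  left σ x = amount x - s * (stop σ x - now σ)

  piece : State → Item → Piece
  piece σ x = record { pg = page (req x) ; tid = transmission (next σ) x ; st = now σ ; en = stop σ x }

  serve : State → Item → State
  serve σ x = state (stop σ x) (fresh (next σ) x)
    (mapMaybe (settle (now σ) x (transmission (next σ) x) (left σ x)) (items σ))
    (piece σ x ∷ pieces σ)

  -- A state without items is a fixed point, so extra steps after halting change nothing.
  idle : State → State
  idle (state t n []       H) = state t n [] H
  idle (state t n (i ∷ is) H) = state (min (arr (req i)) (map (arr ∘ req) is)) n (i ∷ is) H

  stepOn : State → List Item → State
  stepOn σ []       = idle σ
  stepOn σ (a ∷ as) = serve σ (pick (now σ) a as)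

  step : State → State
  step σ = stepOn σ (arrived (now σ) (items σ))

  run : ℕ → State → State
  run ℕ.zero    σ = σ
  run (ℕ.suc N) σ = run N (step σ)

  record Selected (t : ℚ) (is : List Item) (x : Item) : Set where
    field
      member : x ∈ is
      present  : arr (req x) ≤ t
      urgent : ∀ {a} → a ∈ is → arr (req a) ≤ t → ε * wait t a ≤ 6ℚ * wait t x
      best   : ∀ {y} → y ∈ is → arr (req y) ≤ t →
               (∀ {a} → a ∈ is → arr (req a) ≤ t → ε * wait t a ≤ 6ℚ * wait t y) →
               v (req y) ≤ v (req x)

  module _ (0≤ε : 0ℚ ≤ ε) (ε≤6 : ε ≤ 6ℚ) (0≤v : ∀ J → 0ℚ ≤ v J) where

    wait-nonneg : ∀ {t} it → arr (req it) ≤ t → 0ℚ ≤ wait t it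
    wait-nonneg it a≤t = 0≤* (0≤v (req it)) (0≤diff a≤t)

    pick-selected : ∀ t is {a as} → arrived t is ≡ a ∷ as → Selected t is (pick t a as)
    pick-selected t is {a} {as} eq = record
      { member = proj₁ (in-is pick∈)
      ; present  = proj₂ (in-is pick∈)
      ; urgent = λ b∈ b≤ → All.lookup pick-urgent (to-as b∈ b≤)
      ; best   = λ y∈ y≤ u → All.lookup (f[xs]≤f[argmax] (longest t a as) Q)
                   (∈-filter⁺ (urgent? t (a ∷ as)) (to-as y∈ y≤)
                     (All.tabulate λ b∈ → u (proj₁ (in-is b∈)) (proj₂ (in-is b∈))))
      }
      where
      Q : List Item
      Q = filter (urgent? t (a ∷ as)) (a ∷ as)
      in-is : ∀ {b} → b ∈ a ∷ as → b ∈ is × arr (req b) ≤ t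
      in-is b∈ = ∈-filter⁻ _ {xs = is} (subst (_ ∈_) (sym eq) b∈)
      to-as : ∀ {b} → b ∈ is → arr (req b) ≤ t → b ∈ a ∷ as
      to-as b∈ b≤ = subst (_ ∈_) eq (∈-filter⁺ _ b∈ b≤)
      longest∈ : longest t a as ∈ a ∷ as
      longest∈ with argmax-sel (wait t) a as
      ... | inj₁ e = here e
      ... | inj₂ e = there e
      longest-max : ∀ {b} → b ∈ a ∷ as → wait t b ≤ wait t (longest t a as)
      longest-max (here refl) = f[⊥]≤f[argmax] {f = wait t} a as
      longest-max (there b∈)  = All.lookup (f[xs]≤f[argmax] {f = wait t} a as) b∈
      longest-urgent : Urgent t (a ∷ as) (longest t a as)
      longest-urgent = All.tabulate λ b∈ → ≤-trans (*-monoˡ 0≤ε (longest-max b∈))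
        (*-monoʳ-≤-nonNeg (wait t (longest t a as))
          {{nonNegative (wait-nonneg (longest t a as) (proj₂ (in-is longest∈)))}} ε≤6)
      pick∈ : pick t a as ∈ a ∷ as
      pick∈ with argmax-sel (v ∘ req) (longest t a as) Q
      ... | inj₁ e = subst (_∈ a ∷ as) (sym e) longest∈
      ... | inj₂ e = proj₁ (∈-filter⁻ (urgent? t (a ∷ as)) {xs = a ∷ as} e)
      pick-urgent : Urgent t (a ∷ as) (pick t a as)
      pick-urgent with argmax-sel (v ∘ req) (longest t a as) Q
      ... | inj₁ e = subst (Urgent t (a ∷ as)) (sym e) longest-urgent
      ... | inj₂ e = proj₂ (∈-filter⁻ (urgent? t (a ∷ as)) {xs = a ∷ as} e)

-- Invariants and competitive analysis

≢0⇒0< : ∀ {p} → 0ℚ ≤ p → p ≢ 0ℚ → 0ℚ < p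
≢0⇒0< {p} 0≤p p≢0 with <⊎≥ 0ℚ p
... | inj₁ 0<p = 0<p
... | inj₂ p≤0 = contradiction (≤-antisym p≤0 0≤p) p≢0

module Steps
  (mode : Mode) (s r ε : ℚ) (ℓ : Lengths) (v : Request → ℚ)
  (0<s : 0ℚ < s) (0<r : 0ℚ < r) (s*r≡1 : s * r ≡ 1ℚ) (0<ℓ : ∀ p → 0ℚ < ℓ p)
  (short : mode ≡ nonPreemptive → ∀ p q → ℓ p * r ≤ ℓ q)
  where

  open Algorithm mode s r ε ℓ v public

  t<bound : ∀ t it → t < bound t it
  t<bound t it with arr (req it) ≤? t
  ... | yes _  = subst (_< t + ℓ (page (req it))) (+-identityʳ t) (+-monoʳ-< t (0<ℓ _))
  ... | no a≰t = ≰⇒> a≰t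

  bound-arrived : ∀ t it → arr (req it) ≤ t → bound t it ≡ t + ℓ (page (req it))
  bound-arrived t it a≤t with arr (req it) ≤? t
  ... | yes _  = refl
  ... | no a≰t = contradiction a≤t a≰t

  bound-future : ∀ t it → t < arr (req it) → bound t it ≡ arr (req it)
  bound-future t it t<a with arr (req it) ≤? t
  ... | yes a≤t = ⊥-elim (<-irrefl refl (<-≤-trans t<a a≤t))
  ... | no _    = refl

  arr<bound⇒ : ∀ t it → arr (req it) < bound t it → bound t it ≡ t + ℓ (page (req it))
  arr<bound⇒ t it a<b with arr (req it) ≤? t
  ... | yes _ = refl
  ... | no _  = contradiction a<b (<-irrefl refl)

  stopAt-sel : ∀ m t w is → stopAt m t w is ≡ t + w * r ⊎ ∃[ it ] (it ∈ is × stopAt m t w is ≡ bound t it)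
  stopAt-sel nonPreemptive t w is = inj₁ refl
  stopAt-sel preemptive    t w is with argmin-sel id (t + w * r) (map (bound t) is)
  ... | inj₁ e = inj₁ e
  ... | inj₂ b∈ = let it , it∈ , e = ∈-map⁻ (bound t) b∈ in inj₂ (it , it∈ , e)

  stopAt-≤full : ∀ m t w is → stopAt m t w is ≤ t + w * r
  stopAt-≤full nonPreemptive t w is = ≤-refl
  stopAt-≤full preemptive    t w is = min≤⊤ (t + w * r) (map (bound t) is)

  stopAt-≤bound : ∀ t w {is it} → it ∈ is → stopAt preemptive t w is ≤ bound t it
  stopAt-≤bound t w {is} it∈ = All.lookup (min≤xs (t + w * r) (map (bound t) is)) (∈-map⁺ (bound t) it∈)

  <-full : ∀ t {w} → 0ℚ < w → t < t + w * r
  <-full t {w} 0<w = subst (_< t + w * r) (+-identityʳ t) (+-monoʳ-< t (0<* 0<w 0<r))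

  stopAt-> : ∀ m t {w} is → 0ℚ < w → t < stopAt m t w is
  stopAt-> m t {w} is 0<w with stopAt-sel m t w is
  ... | inj₁ e            = subst (t <_) (sym e) (<-full t 0<w)
  ... | inj₂ (it , _ , e) = subst (t <_) (sym e) (t<bound t it)

  s*full : ∀ t w → s * ((t + w * r) - t) ≡ w
  s*full t w = trans (lemma s r t w) (trans (cong (w *_) s*r≡1) (*-identityʳ w))
    where
    lemma : ∀ s r t w → s * ((t + w * r) - t) ≡ w * (s * r)
    lemma = solve-∀ ℚ-ring

  s*stopAt≤ : ∀ m t w is → s * (stopAt m t w is - t) ≤ w
  s*stopAt≤ m t w is = ≤-trans (*-monoˡ (<⇒≤ 0<s) (+-monoˡ-≤ (- t) (stopAt-≤full m t w is)))
                               (≤-reflexive (s*full t w))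

  -- With preemption this is built into the stopping time, since a future request stops the server
  -- at its arrival and a pending one after its page length. For unit pages it is `short`.
  stopAt-short : ∀ m t w {is it p} → (m ≡ nonPreemptive → mode ≡ nonPreemptive × w ≡ ℓ p) → it ∈ is →
    arr (req it) < stopAt m t w is → stopAt m t w is - t ≤ ℓ (page (req it))
  stopAt-short nonPreemptive t w {it = it} {p} np it∈ a< with np refl
  ... | np′ , refl = ≤-trans (≤-reflexive (lemma t (ℓ p * r))) (short np′ p (page (req it)))
    where
    lemma : ∀ a b → (a + b) - a ≡ b
    lemma = solve-∀ ℚ-ring
  stopAt-short preemptive t w {is} {it} np it∈ a< = ≤-trans
    (+-monoˡ-≤ (- t) (≤-trans (stopAt-≤bound t w it∈)
      (≤-reflexive (arr<bound⇒ t it (<-≤-trans a< (stopAt-≤bound t w {is} it∈))))))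
    (≤-reflexive (lemma t (ℓ (page (req it)))))
    where
    lemma : ∀ a b → (a + b) - a ≡ b
    lemma = solve-∀ ℚ-ring

  settle-cases : ∀ t x k w it {it′} → settle t x k w it ≡ just it′ →
    (¬ Covered t x it × it′ ≡ it) ⊎ (Covered t x it × w ≢ 0ℚ × it′ ≡ item (req it) (just (k , w)))
  settle-cases t x k w it e with covered? t x it | w ≟ 0ℚ
  settle-cases t x k w it ()   | yes c | yes _
  settle-cases t x k w it refl | yes c | no ≢0 = inj₂ (c , ≢0 , refl)
  settle-cases t x k w it refl | no ¬c | _     = inj₁ (¬c , refl)

  settle-total : ∀ t x k w it → (Covered t x it × w ≡ 0ℚ) ⊎ ∃[ it′ ] (settle t x k w it ≡ just it′ × req it′ ≡ req it)
  settle-total t x k w it with covered? t x it | w ≟ 0ℚ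
  ... | yes c | yes e = inj₁ (c , e)
  ... | yes c | no _  = inj₂ (_ , refl , refl)
  ... | no _  | _     = inj₂ (_ , refl , refl)

  module _ (σ : State) (x : Item) where

    private
      k = transmission (next σ) x

    settled : ∀ {it′} → it′ ∈ items (serve σ x) → ∃[ it ] (it ∈ items σ ×
      ((¬ Covered (now σ) x it × it′ ≡ it) ⊎
       (Covered (now σ) x it × left σ x ≢ 0ℚ × it′ ≡ item (req it) (just (k , left σ x)))))
    settled it′∈ = let it , it∈ , e = ∈-mapMaybe⁻ _ (items σ) it′∈ in
                   it , it∈ , settle-cases (now σ) x k (left σ x) it e

    pending-or-done : ∀ {it} → it ∈ items σ → (Covered (now σ) x it × left σ x ≡ 0ℚ) ⊎
                      ∃[ it′ ] (it′ ∈ items (serve σ x) × req it′ ≡ req it)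
    pending-or-done {it} it∈ with settle-total (now σ) x k (left σ x) it
    ... | inj₁ c             = inj₁ c
    ... | inj₂ (it′ , e , q) = inj₂ (it′ , ∈-mapMaybe⁺ _ it∈ e , q)

  -- `serves` says that the request was there before every piece of its transmission; completing
  -- that transmission then satisfies it.
  record Running (H : Schedule) (it : Item) (k : ℕ) (w : ℚ) : Set where
    field
      0<rest  : 0ℚ < w
      total   : s * dur H k + w ≡ ℓ (page (req it))
      started : ∃[ y ] (y ∈ H × tid y ≡ k)
      serves  : ∀ {y} → y ∈ H → tid y ≡ k → pg y ≡ page (req it) × arr (req it) ≤ st y

  -- `unique` lets a continued transmission serve all started requests for its page: they share one
  -- number, hence one remaining amount.
  record Inv (σ : State) : Set where
    field
      past    : ∀ {y} → y ∈ pieces σ → st y < en y × en y ≤ now σ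
      disj    : AllPairs Disjoint (pieces σ)
      used    : ∀ {y} → y ∈ pieces σ → tid y <ℕ next σ
      same    : ∀ {y z} → y ∈ pieces σ → z ∈ pieces σ → tid y ≡ tid z → pg y ≡ pg z
      capped  : ∀ {y} → y ∈ pieces σ → s * dur (pieces σ) (tid y) ≤ ℓ (pg y)
      running : ∀ {it k w} → it ∈ items σ → cur it ≡ just (k , w) → Running (pieces σ) it k w
      unique  : ∀ {it it′ k k′ w w′} → it ∈ items σ → it′ ∈ items σ → page (req it) ≡ page (req it′) →
                cur it ≡ just (k , w) → cur it′ ≡ just (k′ , w′) → k ≡ k′
      whole   : mode ≡ nonPreemptive → (∀ {it} → it ∈ items σ → cur it ≡ nothing) ×
                NonPreemptive s ℓ (pieces σ)

    proper : Proper (pieces σ)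
    proper y∈ = proj₁ (past y∈)

    running-arrived : ∀ {it k w} → it ∈ items σ → cur it ≡ just (k , w) → arr (req it) ≤ now σ
    running-arrived it∈ c with Running.started (running it∈ c)
    ... | y , y∈ , e = ≤-trans (proj₂ (Running.serves (running it∈ c) y∈ e))
                               (≤-trans (<⇒≤ (proj₁ (past y∈))) (proj₂ (past y∈)))

    running-< : ∀ {it k w} → it ∈ items σ → cur it ≡ just (k , w) → k <ℕ next σ
    running-< it∈ c with Running.started (running it∈ c)
    ... | y , y∈ , refl = used y∈

  -- What starting and continuing a transmission have in common, so that preservation of the
  -- invariant is proved once for both.
  record Plan (σ : State) (x : Item) : Set where
    private
      k = transmission (next σ) x
    field
      0<amount : 0ℚ < amount x
      total    : s * dur (pieces σ) k + amount x ≡ ℓ (page (req x))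
      k<       : k <ℕ fresh (next σ) x
      next≤    : next σ ≤ℕ fresh (next σ) x
      pages    : ∀ {y} → y ∈ pieces σ → tid y ≡ k → pg y ≡ page (req x)
      joined   : ∀ {it} → it ∈ items σ → Covered (now σ) x it → arr (req it) ≤ now σ ×
                 (∀ {y} → y ∈ pieces σ → tid y ≡ k → arr (req it) ≤ st y)
      others   : ∀ {it k′ w′} → it ∈ items σ → ¬ Covered (now σ) x it → cur it ≡ just (k′ , w′) → k′ ≢ k
      covers   : ∀ {it k′ w′} → it ∈ items σ → page (req x) ≡ page (req it) → cur it ≡ just (k′ , w′) →
                 Covered (now σ) x it

  is-just-inv : {A : Set} (m : Maybe A) → T (is-just m) → ∃[ a ] (m ≡ just a)
  is-just-inv (just a) _ = a , refl

  plan : ∀ σ x → Inv σ → x ∈ items σ → arr (req x) ≤ now σ → Plan σ x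
  plan σ (item J nothing) inv x∈ a≤t = record
    { 0<amount = 0<ℓ (page J)
    ; total    = trans (cong (λ d → s * d + ℓ (page J)) (dur-absent (pieces σ) (next σ) unused))
                       (trans (cong (_+ ℓ (page J)) (*-zeroʳ s)) (+-identityˡ _))
    ; k<       = ℕₚ.n<1+n (next σ)
    ; next≤    = ℕₚ.n≤1+n (next σ)
    ; pages    = λ y∈ e → ⊥-elim (unused y∈ e)
    ; joined   = λ it∈ c → proj₂ c , λ y∈ e → ⊥-elim (unused y∈ e)
    ; others   = λ it∈ _ c e → ℕₚ.<-irrefl e (running-< it∈ c)
    -- Started requests have arrived, so a fresh transmission takes them over too; their older
    -- transmission is abandoned.
    ; covers   = λ it∈ p c → p , running-arrived it∈ c
    }
    where
    open Inv inv
    unused : ∀ {y} → y ∈ pieces σ → tid y ≢ next σ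
    unused y∈ e = ℕₚ.<-irrefl e (used y∈)
  plan σ x@(item J (just (k , w))) inv x∈ a≤t = record
    { 0<amount = Running.0<rest rx
    ; total    = Running.total rx
    ; k<       = running-< x∈ refl
    ; next≤    = ℕₚ.≤-refl
    ; pages    = λ y∈ e → proj₁ (Running.serves rx y∈ e)
    ; joined   = joined
    ; others   = λ it∈ ¬c c e → ¬c (other it∈ c e)
    ; covers   = λ it∈ p c → p , subst (T ∘ is-just) (sym c) tt
    }
    where
    open Inv inv
    rx : Running (pieces σ) x k w
    rx = running x∈ refl
    joined : ∀ {it} → it ∈ items σ → Covered (now σ) x it → arr (req it) ≤ now σ ×
             (∀ {y} → y ∈ pieces σ → tid y ≡ k → arr (req it) ≤ st y)
    joined {it} it∈ (p , j) with is-just-inv (cur it) j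
    ... | (k′ , w′) , c with unique x∈ it∈ p refl c
    ...   | refl = running-arrived it∈ c , λ y∈ e → proj₂ (Running.serves (running it∈ c) y∈ e)
    -- Equal numbers share a piece, and that piece fixes the page.
    other : ∀ {it k′ w′} → it ∈ items σ → cur it ≡ just (k′ , w′) → k′ ≡ k → Covered (now σ) x it
    other it∈ c refl with Running.started rx
    ... | y , y∈ , e = trans (sym (proj₁ (Running.serves rx y∈ e))) (proj₁ (Running.serves (running it∈ c) y∈ e))
                     , subst (T ∘ is-just) (sym c) tt

  Finished : Schedule → Request → ℚ → Set
  Finished = FinishedBy s ℓ

  module Serve (σ : State) (x : Item) (inv : Inv σ) (x∈ : x ∈ items σ) (a≤t : arr (req x) ≤ now σ) where

    open Inv inv
    open Plan (plan σ x inv x∈ a≤t) public hiding (total)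

    private
      t  = now σ
      e  = stop σ x
      k  = transmission (next σ) x
      p  = page (req x)
      w  = left σ x
      H  = pieces σ
      y₀ = piece σ x

    total₀ : s * dur H k + amount x ≡ ℓ p
    total₀ = Plan.total (plan σ x inv x∈ a≤t)

    t<e : t < e
    t<e = stopAt-> mode t (items σ) 0<amount

    0≤left : 0ℚ ≤ w
    0≤left = 0≤diff (s*stopAt≤ mode t (amount x) (items σ))

    np-nothing : mode ≡ nonPreemptive → cur x ≡ nothing
    np-nothing np = proj₁ (whole np) x∈

    np-fresh : mode ≡ nonPreemptive → k ≡ next σ × amount x ≡ ℓ p
    np-fresh np = lemma x (np-nothing np)
      where
      lemma : ∀ x → cur x ≡ nothing → transmission (next σ) x ≡ next σ × amount x ≡ ℓ (page (req x))
      lemma (item J nothing) _ = refl , refl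

    np-left : mode ≡ nonPreemptive → s * (e - t) ≡ amount x
    np-left refl = s*full t (amount x)

    np-left≡0 : mode ≡ nonPreemptive → w ≡ 0ℚ
    np-left≡0 np = trans (cong (λ d → amount x - d) (np-left np)) (+-inverseʳ (amount x))

    e-short : ∀ {it} → it ∈ items σ → arr (req it) < e → e - t ≤ ℓ (page (req it))
    e-short it∈ = stopAt-short mode t (amount x) {p = p} (λ np → np , proj₂ (np-fresh np)) it∈

    dur-k : dur (y₀ ∷ H) k ≡ (e - t) + dur H k
    dur-k = dur-same y₀ H refl

    total₁ : s * dur (y₀ ∷ H) k + w ≡ ℓ p
    total₁ = trans (cong (λ d → s * d + w) dur-k) (trans (lemma s (e - t) (dur H k) (amount x)) total₀)
      where
      lemma : ∀ s a d b → s * (a + d) + (b - s * a) ≡ s * d + b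
      lemma = solve-∀ ℚ-ring

    used-≢ : ∀ {z} → z ∈ H → mode ≡ nonPreemptive → tid z ≢ k
    used-≢ z∈ np eq = ℕₚ.<-irrefl (trans eq (proj₁ (np-fresh np))) (used z∈)

    serves₁ : ∀ {it} → it ∈ items σ → Covered t x it → ∀ {y} → y ∈ y₀ ∷ H → tid y ≡ k →
              pg y ≡ page (req it) × arr (req it) ≤ st y × en y ≤ e
    serves₁ it∈ c (here refl) eq = proj₁ c , proj₁ (joined it∈ c) , ≤-refl
    serves₁ it∈ c (there y∈)  eq = trans (pages y∈ eq) (proj₁ c) , proj₂ (joined it∈ c) y∈ eq ,
                                   ≤-trans (proj₂ (past y∈)) (<⇒≤ t<e)

    running-other : ∀ {it k′ w′} → it ∈ items σ → k′ ≢ k → Running H it k′ w′ → Running (y₀ ∷ H) it k′ w′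
    running-other {it} {k′} {w′} it∈ k′≢ ρ = record
      { 0<rest  = 0<rest
      ; total   = trans (cong (λ d → s * d + w′) (dur-other y₀ H (k′≢ ∘ sym))) total
      ; started = let y , y∈ , eq = started in y , there y∈ , eq
      ; serves  = serves′
      }
      where
      open Running ρ
      serves′ : ∀ {y} → y ∈ y₀ ∷ H → tid y ≡ k′ → pg y ≡ page (req it) × arr (req it) ≤ st y
      serves′ (here refl) eq = contradiction (sym eq) k′≢
      serves′ (there y∈)  eq = serves y∈ eq

    running-covered : ∀ {it} → it ∈ items σ → Covered t x it → w ≢ 0ℚ →
                      Running (y₀ ∷ H) (item (req it) (just (k , w))) k w
    running-covered it∈ c w≢0 = record
      { 0<rest  = ≢0⇒0< 0≤left w≢0
      ; total   = trans total₁ (cong ℓ (proj₁ c))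
      ; started = y₀ , here refl , refl
      ; serves  = λ y∈ eq → let q , a , _ = serves₁ it∈ c y∈ eq in q , a
      }

    inv′ : Inv (serve σ x)
    inv′ = record
      { past    = past′
      ; disj    = All.tabulate (λ z∈ → inj₂ (proj₂ (past z∈))) ∷ disj
      ; used    = used′
      ; same    = same′
      ; capped  = capped′
      ; running = running′
      ; unique  = unique′
      ; whole   = whole′
      }
      where
      past′ : ∀ {y} → y ∈ y₀ ∷ H → st y < en y × en y ≤ e
      past′ (here refl) = t<e , ≤-refl
      past′ (there y∈)  = proj₁ (past y∈) , ≤-trans (proj₂ (past y∈)) (<⇒≤ t<e)
      used′ : ∀ {y} → y ∈ y₀ ∷ H → tid y <ℕ fresh (next σ) x
      used′ (here refl) = k<
      used′ (there y∈)  = ℕₚ.<-≤-trans (used y∈) next≤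
      same′ : ∀ {y z} → y ∈ y₀ ∷ H → z ∈ y₀ ∷ H → tid y ≡ tid z → pg y ≡ pg z
      same′ (here refl) (here refl) _  = refl
      same′ (here refl) (there z∈)  eq = sym (pages z∈ (sym eq))
      same′ (there y∈)  (here refl) eq = pages y∈ eq
      same′ (there y∈)  (there z∈)  eq = same y∈ z∈ eq
      capped-k : s * dur (y₀ ∷ H) k ≤ ℓ p
      capped-k = ≤-diff w 0≤left (trans (lemma (s * dur (y₀ ∷ H) k) w) (cong (_- s * dur (y₀ ∷ H) k) total₁))
        where
        lemma : ∀ a b → b ≡ (a + b) - a
        lemma = solve-∀ ℚ-ring
      capped′ : ∀ {y} → y ∈ y₀ ∷ H → s * dur (y₀ ∷ H) (tid y) ≤ ℓ (pg y)
      capped′ (here refl) = capped-k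
      capped′ {y} (there y∈) = go (k ≟ℕ tid y)
        where
        go : Dec (k ≡ tid y) → s * dur (y₀ ∷ H) (tid y) ≤ ℓ (pg y)
        go (yes eq) = subst₂ (λ k q → s * dur (y₀ ∷ H) k ≤ ℓ q) eq (sym (pages y∈ (sym eq))) capped-k
        go (no neq) = ≤-trans (≤-reflexive (cong (s *_) (dur-other y₀ H neq))) (capped y∈)
      running′ : ∀ {it k′ w′} → it ∈ items (serve σ x) → cur it ≡ just (k′ , w′) → Running (y₀ ∷ H) it k′ w′
      running′ it∈′ c with settled σ x it∈′
      running′ it∈′ c    | it , it∈ , inj₁ (¬c , refl)     = running-other it∈ (others it∈ ¬c c) (running it∈ c)
      running′ it∈′ refl | it , it∈ , inj₂ (cov , w≢ , refl) = running-covered it∈ cov w≢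
      unique′ : ∀ {it it′ k k′ w w′} → it ∈ items (serve σ x) → it′ ∈ items (serve σ x) →
                page (req it) ≡ page (req it′) → cur it ≡ just (k , w) → cur it′ ≡ just (k′ , w′) → k ≡ k′
      unique′ a∈ b∈ q c d with settled σ x a∈ | settled σ x b∈
      unique′ a∈ b∈ q c d | a , a∈′ , inj₁ (_ , refl) | b , b∈′ , inj₁ (_ , refl) = unique a∈′ b∈′ q c d
      -- A started item for the page of `x` would have been covered.
      unique′ a∈ b∈ q c d | a , a∈′ , inj₁ (¬c , refl) | b , b∈′ , inj₂ (cov , _ , refl) =
        contradiction (covers a∈′ (trans (proj₁ cov) (sym q)) c) ¬c
      unique′ a∈ b∈ q c d | a , a∈′ , inj₂ (cov , _ , refl) | b , b∈′ , inj₁ (¬c , refl) =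
        contradiction (covers b∈′ (trans (proj₁ cov) q) d) ¬c
      unique′ a∈ b∈ q refl refl | a , a∈′ , inj₂ (_ , _ , refl) | b , b∈′ , inj₂ (_ , _ , refl) = refl
      whole′ : mode ≡ nonPreemptive → (∀ {it} → it ∈ items (serve σ x) → cur it ≡ nothing) ×
               NonPreemptive s ℓ (y₀ ∷ H)
      whole′ np = nothings , (All.tabulate (λ z∈ eq → used-≢ z∈ np (sym eq)) ∷ proj₁ (proj₂ (whole np))) , exact
        where
        nothings : ∀ {it} → it ∈ items (serve σ x) → cur it ≡ nothing
        nothings it∈′ with settled σ x it∈′
        ... | it , it∈ , inj₁ (_ , refl) = proj₁ (whole np) it∈
        ... | it , it∈ , inj₂ (_ , w≢ , _) = contradiction (np-left≡0 np) w≢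
        exact : ∀ {y} → y ∈ y₀ ∷ H → s * (en y - st y) ≡ ℓ (pg y)
        exact (here refl) = trans (np-left np) (proj₂ (np-fresh np))
        exact (there y∈)  = proj₂ (proj₂ (whole np)) y∈

    finished-now : ∀ {it} → it ∈ items σ → Covered t x it → w ≡ 0ℚ → Finished (y₀ ∷ H) (req it) e
    finished-now it∈ c w≡0 = k , trans (trans (sym (+-identityʳ _)) (trans (cong (s * dur (y₀ ∷ H) k +_) (sym w≡0)) total₁))
                                       (cong ℓ (proj₁ c))
                               , serves₁ it∈ c

    -- A complete transmission is never prolonged: transmission `k` still had a positive amount to
    -- send before this step, so the complete one has another number.
    finished-later : ∀ {J f} → Finished H J f → Finished (y₀ ∷ H) J f
    finished-later {J} {f} (k′ , full , ok) = k′ , trans (cong (s *_) (dur-other y₀ H k≢)) full , ok′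
      where
      -- A full duration is positive, so there is a piece that shows the page of `k′`.
      present : ∃[ z ] (z ∈ H × tid z ≡ k′)
      present = dur-present H k′ (≢0⇒0< (dur-nonneg H k′ proper)
        λ z → <-irrefl (trans (sym (*-zeroʳ s)) (trans (cong (s *_) (sym z)) full)) (0<ℓ (page J)))
      k≢ : k ≢ k′
      k≢ refl with present
      ... | z , z∈ , refl = <-irrefl (sym (lemma _ _ (trans (cong (_+ amount x) (sym (trans full
              (cong ℓ (trans (sym (proj₁ (ok z∈ refl))) (pages z∈ refl)))))) total₀))) 0<amount
        where
        lemma : ∀ a b → a + b ≡ a → b ≡ 0ℚ
        lemma a b h = trans (solved a b) (trans (cong (_- a) h) (+-inverseʳ a))
          where
          solved : ∀ a b → b ≡ (a + b) - a
          solved = solve-∀ ℚ-ring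
      ok′ : ∀ {y} → y ∈ y₀ ∷ H → tid y ≡ k′ → pg y ≡ page J × arr J ≤ st y × en y ≤ f
      ok′ (here refl) eq = contradiction eq k≢
      ok′ (there y∈)  eq = ok y∈ eq

1≤6ℚ : 1ℚ ≤ 6ℚ
1≤6ℚ = ≤ᵇ⇒≤ tt

scale≤ : ∀ {e q} → 0ℚ ≤ e → e ≤ 1ℚ → 0ℚ ≤ q → e * q ≤ q
scale≤ {e} {q} 0≤e e≤1 0≤q = ≤-trans (*-monoʳ-≤-nonNeg q {{nonNegative 0≤q}} e≤1) (≤-reflexive (*-identityˡ q))

p-q≤0 : ∀ {p q} → p ≤ q → p - q ≤ 0ℚ
p-q≤0 {p} {q} p≤q = ≤-trans (+-monoˡ-≤ (- q) p≤q) (≤-reflexive (+-inverseʳ q))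

-- Case analysis of a step, and preservation of the invariant.

module Views
  (mode : Mode) (s r ε : ℚ) (ℓ : Lengths) (v : Request → ℚ)
  (0<s : 0ℚ < s) (0<r : 0ℚ < r) (s*r≡1 : s * r ≡ 1ℚ) (0<ℓ : ∀ p → 0ℚ < ℓ p)
  (short : mode ≡ nonPreemptive → ∀ p q → ℓ p * r ≤ ℓ q)
  (0<ε : 0ℚ < ε) (ε≤1 : ε ≤ 1ℚ) (0≤v : ∀ J → 0ℚ ≤ v J)
  where

  open Steps mode s r ε ℓ v 0<s 0<r s*r≡1 0<ℓ short public

  0≤ε : 0ℚ ≤ ε
  0≤ε = <⇒≤ 0<ε

  IsNextArrival : ℚ → List Item → Set
  IsNextArrival t is = (∃[ it ] (it ∈ is × t ≡ arr (req it))) × (∀ {it} → it ∈ is → t ≤ arr (req it))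

  data IdleView : State → State → Set where
    halted : ∀ {t n H} → IdleView (state t n [] H) (state t n [] H)
    waited : ∀ {t n is H} t′ → IsNextArrival t′ is → IdleView (state t n is H) (state t′ n is H)

  idle-view : ∀ σ → IdleView σ (idle σ)
  idle-view (state t n [] H)       = halted
  idle-view (state t n (i ∷ is) H) = waited _ (attained , least)
    where
    attained : ∃[ it ] (it ∈ i ∷ is × min (arr (req i)) (map (arr ∘ req) is) ≡ arr (req it))
    attained with argmin-sel id (arr (req i)) (map (arr ∘ req) is)
    ... | inj₁ e  = i , here refl , e
    ... | inj₂ m∈ = let it , it∈ , e = ∈-map⁻ (arr ∘ req) m∈ in it , there it∈ , e
    least : ∀ {it} → it ∈ i ∷ is → min (arr (req i)) (map (arr ∘ req) is) ≤ arr (req it)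
    least (here refl) = min≤⊤ (arr (req i)) (map (arr ∘ req) is)
    least (there it∈) = All.lookup (min≤xs (arr (req i)) (map (arr ∘ req) is)) (∈-map⁺ (arr ∘ req) it∈)

  -- Replaces the defining equation of `step` by what the analysis needs of it, so that the choice
  -- is never unfolded there.
  data StepView (σ : State) : State → Set where
    idled  : (∀ {it} → it ∈ items σ → now σ < arr (req it)) → ∀ {σ′} → IdleView σ σ′ → StepView σ σ′
    served : ∀ x → Selected (now σ) (items σ) x → StepView σ (serve σ x)

  step-view : ∀ σ → StepView σ (step σ)
  step-view σ with arrived (now σ) (items σ) in eq
  ... | []     = idled (λ {it} it∈ → ≰⇒> λ a≤t → none (subst (it ∈_) eq (∈-filter⁺ _ it∈ a≤t))) (idle-view σ)
    where
    none : ∀ {it : Item} → ¬ it ∈ []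
    none ()
  ... | a ∷ as = served _ (pick-selected 0≤ε (≤-trans ε≤1 1≤6ℚ) 0≤v (now σ) (items σ) eq)

  idle-inv : ∀ {σ σ′} → Inv σ → (∀ {it} → it ∈ items σ → now σ < arr (req it)) → IdleView σ σ′ → Inv σ′
  idle-inv inv none halted = inv
  idle-inv {σ} inv none (waited t′ ((it , it∈ , refl) , _)) = record
    { past    = λ y∈ → proj₁ (past y∈) , ≤-trans (proj₂ (past y∈)) (<⇒≤ (none it∈))
    ; disj    = disj
    ; used    = used
    ; same    = same
    ; capped  = capped
    ; running = running
    ; unique  = unique
    ; whole   = whole
    }
    where open Inv inv

  step-inv : ∀ σ → Inv σ → Inv (step σ)
  step-inv σ inv with step σ | step-view σ
  ... | _ | idled none iv = idle-inv inv none iv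
  ... | _ | served x sel  = Serve.inv′ σ x inv (Selected.member sel) (Selected.present sel)

  -- The clock value 0 is a placeholder: if there are requests, `idle` moves the clock to the
  -- earliest arrival, which may be negative.
  initial : Instance → State
  initial I = idle (state 0ℚ 0 (map waiting I) [])

  initial-nothing : ∀ I {it} → it ∈ map waiting I → cur it ≡ nothing
  initial-nothing I it∈ with ∈-map⁻ _ it∈
  ... | J , _ , refl = refl

  initial-inv : ∀ I → Inv (initial I)
  initial-inv I with idle (state 0ℚ 0 (map waiting I) []) | idle-view (state 0ℚ 0 (map waiting I) [])
  ... | _ | iv = go iv (initial-nothing I)
    where
    go : ∀ {is σ′} → IdleView (state 0ℚ 0 is []) σ′ → (∀ {it} → it ∈ is → cur it ≡ nothing) → Inv σ′
    fields : ∀ {t is} → (∀ {it} → it ∈ is → cur it ≡ nothing) → Inv (state t 0 is [])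
    fields none = record
      { past    = λ ()
      ; disj    = []
      ; used    = λ ()
      ; same    = λ ()
      ; capped  = λ ()
      ; running = λ it∈ c → case-absurd (trans (sym (none it∈)) c)
      ; unique  = λ it∈ _ _ c _ → case-absurd (trans (sym (none it∈)) c)
      ; whole   = λ _ → none , [] , λ ()
      }
      where
      case-absurd : ∀ {a : ℕ × ℚ} {X : Set} → nothing ≡ just a → X
      case-absurd ()
    go halted       none = fields none
    go (waited _ _) none = fields none

-- Charging the work of the server to the offline schedule.

module Analysis
  (mode : Mode) (s r ε : ℚ) (ℓ : Lengths) (v : Request → ℚ)
  (0<s : 0ℚ < s) (0<r : 0ℚ < r) (s*r≡1 : s * r ≡ 1ℚ) (0<ℓ : ∀ p → 0ℚ < ℓ p)
  (short : mode ≡ nonPreemptive → ∀ p q → ℓ p * r ≤ ℓ q)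
  (0<ε : 0ℚ < ε) (ε≤1 : ε ≤ 1ℚ) (0≤v : ∀ J → 0ℚ ≤ v J)
  (speed-np : mode ≡ nonPreemptive → s ≡ 1ℚ + ε) (speed-pr : mode ≡ preemptive → s ≡ (1ℚ + 1ℚ) + ε)
  (S : Schedule) (B : ℚ) (S-proper : Proper S) (S-disjoint : AllPairs Disjoint S)
  where

  open Views mode s r ε ℓ v 0<s 0<r s*r≡1 0<ℓ short 0<ε ε≤1 0≤v public

  record Opt (J : Request) : Set where
    field
      oid    : ℕ
      fin    : ℚ
      oid-dur : dur S oid ≡ ℓ (page J)
      oid-ok  : ∀ {z} → z ∈ S → tid z ≡ oid → pg z ≡ page J × arr J ≤ st z × en z ≤ fin
      fin≤B   : v J * (fin - arr J) ≤ B

    oid-present : ∃[ z ] (z ∈ S × tid z ≡ oid)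
    oid-present = dur-present S oid (subst (0ℚ <_) (sym oid-dur) (0<ℓ (page J)))

    -- At speed 1 the whole page is sent between arrival and finish. This bounds the growth of a
    -- weighted wait over one page length by `B`.
    length≤ : ℓ (page J) ≤ fin - arr J
    length≤ = ≤-trans (≤-reflexive (trans (sym oid-dur) (sym (+-identityʳ _))))
      (volume S (oid ∷ []) S-proper S-disjoint ([] ∷ []) arr≤fin
        λ { z∈ (here e) → proj₂ (oid-ok z∈ e) })
      where
      arr≤fin : arr J ≤ fin
      arr≤fin = let z , z∈ , e = oid-present in
        ≤-trans (proj₁ (proj₂ (oid-ok z∈ e))) (≤-trans (<⇒≤ (S-proper z∈)) (proj₂ (proj₂ (oid-ok z∈ e))))

    v*ℓ≤B : v J * ℓ (page J) ≤ B
    v*ℓ≤B = ≤-trans (*-monoˡ (0≤v J) length≤) fin≤B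

    0≤B : 0ℚ ≤ B
    0≤B = ≤-trans (0≤* (0≤v J) (<⇒≤ (0<ℓ (page J)))) v*ℓ≤B

    v*[·]≤B : ∀ {d} → d ≤ ℓ (page J) → v J * d ≤ B
    v*[·]≤B d≤ = ≤-trans (*-monoˡ (0≤v J) d≤) v*ℓ≤B

  D : ℚ
  D = 6ℚ * B

  -- The algorithm's transmission num, of page on, is charged to the
  -- transmission opt of S.
  record Charge : Set where
    constructor charge
    field
      num on opt : ℕ
  open Charge

  record ChargeOK (θ t₀ : ℚ) (σ : State) (c : Charge) : Set where
    field
      begun   : ∃[ y ] (y ∈ pieces σ × tid y ≡ num c × pg y ≡ on c)
      opt-dur : dur S (opt c) ≡ ℓ (on c)
      window  : ∀ {z} → z ∈ S → tid z ≡ opt c →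
                pg z ≡ on c × ε * (θ * (t₀ - st z)) ≤ D + B × en z ≤ now σ

  -- Since t₀ the server has been working only for requests of weight at least
  -- θ, on the transmissions in new (begun since t₀) and old (begun before).
  record Seg (θ t₀ : ℚ) (σ : State) : Set where
    field
      new old  : List Charge
      t₀≤now   : t₀ ≤ now σ
      claim    : ∀ {it} → it ∈ items σ → θ ≤ v (req it) → ε * (v (req it) * (t₀ - arr (req it))) ≤ D + B
      -- Here `dur` counts whole transmissions, so an old one also contributes its part before `t₀`.
      work     : now σ - t₀ ≤ ∑ (dur (pieces σ)) (map num new) + ∑ (dur (pieces σ)) (map num old)
      new-ok   : ∀ {c} → c ∈ new → ChargeOK θ t₀ σ c
      old-ok   : ∀ {c} → c ∈ old → ChargeOK θ t₀ σ c
      new-uniq : Unique (map opt new)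
      old-uniq : Unique (map opt old)
      -- Keeps `new-uniq` alive: the charged offline transmission is over before a still waiting
      -- request arrives and so cannot serve it.
      later    : ∀ {c} → c ∈ new → ∀ {it} → it ∈ items σ → cur it ≡ nothing → page (req it) ≡ on c →
                 ∀ {z} → z ∈ S → tid z ≡ opt c → en z ≤ arr (req it)
      -- Keeps `old-uniq` alive: no second transmission of the page can become old.
      taken    : ∀ {c} → c ∈ old → ∀ {it k w} → it ∈ items σ → page (req it) ≡ on c → cur it ≡ just (k , w) →
                 k ≡ num c ⊎ k ∈ map num new
      np-old   : mode ≡ nonPreemptive → old ≡ []

  new-segment : ∀ θ σ → (∀ {it} → it ∈ items σ → θ ≤ v (req it) → ε * (v (req it) * (now σ - arr (req it))) ≤ D + B) → Seg θ (now σ) σ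
  new-segment θ σ h = record
    { new = [] ; old = [] ; t₀≤now = ≤-refl ; claim = h
    ; work = ≤-reflexive (+-inverseʳ (now σ))
    ; new-ok = λ () ; old-ok = λ () ; new-uniq = [] ; old-uniq = []
    ; later = λ () ; taken = λ () ; np-old = λ _ → refl }

  module _ {θ t₀ : ℚ} (0<θ : 0ℚ < θ) (σ : State) (inv : Inv σ) (seg : Seg θ t₀ σ) where
    open Inv inv
    open Seg seg

    -- A charged transmission carries at most one page, so `s` times its duration is at most the
    -- duration of its offline counterpart. The counterparts are distinct and fit into the interval.
    charges-volume : ∀ {t₁} cs → (∀ {c} → c ∈ cs → ChargeOK θ t₀ σ c) → Unique (map opt cs) →
      t₁ ≤ now σ → (∀ {u} → ε * (θ * (t₀ - u)) ≤ D + B → t₁ ≤ u) →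
      s * ∑ (dur (pieces σ)) (map num cs) ≤ now σ - t₁
    charges-volume {t₁} cs ok u t₁≤ h = begin
      s * ∑ (dur (pieces σ)) (map num cs)       ≡⟨ cong (s *_) (∑-map (dur (pieces σ)) num cs) ⟩
      s * ∑ (dur (pieces σ) ∘ num) cs           ≡⟨ ∑-*ˡ s (dur (pieces σ) ∘ num) cs ⟨
      ∑ (λ c → s * dur (pieces σ) (num c)) cs   ≤⟨ ∑-mono cs each ⟩
      ∑ (dur S ∘ opt) cs                        ≡⟨ ∑-map (dur S) opt cs ⟨
      ∑ (dur S) (map opt cs)                    ≤⟨ volume S (map opt cs) S-proper S-disjoint u t₁≤ inside ⟩
      now σ - t₁ ∎
      where
      open ≤-Reasoning
      each : ∀ {c} → c ∈ cs → s * dur (pieces σ) (num c) ≤ dur S (opt c)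
      each c∈ with ChargeOK.begun (ok c∈)
      ... | y , y∈ , refl , q = ≤-trans (capped y∈) (≤-reflexive (trans (cong ℓ q) (sym (ChargeOK.opt-dur (ok c∈)))))
      inside : ∀ {z} → z ∈ S → tid z ∈ map opt cs → t₁ ≤ st z × en z ≤ now σ
      inside z∈ o∈ = let c , c∈ , e = ∈-map⁻ opt o∈
                         _ , w , b = ChargeOK.window (ok c∈) z∈ e
                     in h w , b

    -- Both kinds of charged transmissions fit into the segment prolonged to
    -- the left by (D + B) / (ε θ), whereas the server of speed s has been
    -- busy during the whole segment.
    segment-short : 0ℚ ≤ B → ε * (θ * (ε * (now σ - t₀))) ≤ (D + B) + (D + B)
    segment-short 0≤B = final
      where
      g X β : ℚ
      g = ε * θ
      0<g : 0ℚ < g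
      0<g = 0<* 0<ε 0<θ
      instance
        g-nonZero : NonZero g
        g-nonZero = pos⇒nonZero g {{positive 0<g}}
      X = now σ - t₀
      β = (D + B) * 1/ g
      gβ : g * β ≡ D + B
      gβ = trans (lemma g (D + B) (1/ g)) (trans (cong ((D + B) *_) (*-inverseʳ g)) (*-identityʳ (D + B)))
        where
        lemma : ∀ g d i → g * (d * i) ≡ d * (g * i)
        lemma = solve-∀ ℚ-ring
      0≤D+B : 0ℚ ≤ D + B
      0≤D+B = 0≤+ (0≤* 0≤6ℚ 0≤B) 0≤B
      0≤β : 0ℚ ≤ β
      0≤β = *-cancelˡ 0<g (≤-trans (≤-reflexive (*-zeroʳ g)) (≤-trans 0≤D+B (≤-reflexive (sym gβ))))
      bounded : ∀ {u} → ε * (θ * (t₀ - u)) ≤ D + B → t₀ - β ≤ u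
      bounded {u} h = ≤-diff (β - (t₀ - u)) (0≤diff (*-cancelˡ 0<g
          (≤-trans (≤-reflexive (*-assoc ε θ (t₀ - u))) (≤-trans h (≤-reflexive (sym gβ))))))
          (lemma β t₀ u)
        where
        lemma : ∀ b t u → b - (t - u) ≡ u - (t - b)
        lemma = solve-∀ ℚ-ring
      t₁≤now : t₀ - β ≤ now σ
      t₁≤now = ≤-trans (≤-diff β 0≤β (lemma β t₀)) t₀≤now
        where
        lemma : ∀ b t → b ≡ t - (t - b)
        lemma = solve-∀ ℚ-ring
      W : ℚ
      W = now σ - (t₀ - β)
      ΣN ΣO : ℚ
      ΣN = ∑ (dur (pieces σ)) (map num new)
      ΣO = ∑ (dur (pieces σ)) (map num old)
      N≤ : s * ΣN ≤ W
      N≤ = charges-volume new new-ok new-uniq t₁≤now bounded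
      O≤ : s * ΣO ≤ W
      O≤ = charges-volume old old-ok old-uniq t₁≤now bounded
      sX≤ : s * X ≤ s * ΣN + s * ΣO
      sX≤ = ≤-trans (*-monoˡ (<⇒≤ 0<s) work) (≤-reflexive (*-distribˡ-+ s ΣN ΣO))
      εX≤ : ∀ m → mode ≡ m → ε * X ≤ β + β
      -- (1 + ε)X ≤ W = X + β gives εX ≤ β; the second β only gives both modes the same bound.
      εX≤ nonPreemptive refl = ≤-diff ((W - s * X) + β) (0≤+ (0≤diff (≤-trans sX≤ sum≤)) 0≤β)
        (trans (cong (λ a → (W - a * X) + β) (speed-np refl)) (lemma (now σ) t₀ β ε))
        where
        sum≤ : s * ΣN + s * ΣO ≤ W
        sum≤ = ≤-trans (≤-reflexive (trans (cong (λ cs → s * ΣN + s * ∑ (dur (pieces σ)) (map num cs)) (np-old refl))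
                 (trans (cong (s * ΣN +_) (*-zeroʳ s)) (+-identityʳ _)))) N≤
        lemma : ∀ n t b e → ((n - (t - b)) - (1ℚ + e) * (n - t)) + b ≡ (b + b) - e * (n - t)
        lemma = solve-∀ ℚ-ring
      -- (2 + ε)X ≤ 2W = 2X + 2β.
      εX≤ preemptive refl = ≤-diff ((W + W) - s * X) (0≤diff (≤-trans sX≤ (+-mono-≤ N≤ O≤)))
        (trans (cong (λ a → (W + W) - a * X) (speed-pr refl)) (lemma (now σ) t₀ β ε))
        where
        lemma : ∀ n t b e → ((n - (t - b)) + (n - (t - b))) - ((1ℚ + 1ℚ) + e) * (n - t) ≡ (b + b) - e * (n - t)
        lemma = solve-∀ ℚ-ring
      final : ε * (θ * (ε * X)) ≤ (D + B) + (D + B)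
      final = begin
        ε * (θ * (ε * X)) ≡⟨ *-assoc ε θ (ε * X) ⟨
        g * (ε * X)       ≤⟨ *-monoˡ (<⇒≤ 0<g) (εX≤ mode refl) ⟩
        g * (β + β)       ≡⟨ *-distribˡ-+ g β β ⟩
        g * β + g * β     ≡⟨ cong₂ _+_ gβ gβ ⟩
        (D + B) + (D + B) ∎
        where open ≤-Reasoning

  module Extend {θ t₀ : ℚ} (0<θ : 0ℚ < θ) (σ : State) (x : Item) (inv : Inv σ)
    (x∈ : x ∈ items σ) (a≤t : arr (req x) ≤ now σ) (O : Opt (req x))
    (θ≤ : θ ≤ v (req x)) (B≤ : B ≤ wait (now σ) x) (seg : Seg θ t₀ σ) where

    open Inv inv
    open Serve σ x inv x∈ a≤t
    open Seg seg
    open Opt O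

    private
      t  = now σ
      e  = stop σ x
      k  = transmission (next σ) x
      p  = page (req x)
      H  = pieces σ
      y₀ = piece σ x
      σ′ = serve σ x

    -- Both finish times are compared through `B`: v·(fin - a) ≤ B ≤ v·(t - a), where v is at least
    -- θ and hence positive.
    fin≤t : fin ≤ t
    fin≤t = ≤-diff ((t - arr (req x)) - (fin - arr (req x)))
      (0≤diff (*-cancelˡ (<-≤-trans 0<θ θ≤) (≤-trans fin≤B B≤)))
      (lemma t (arr (req x)) fin)
      where
      lemma : ∀ t a f → (t - a) - (f - a) ≡ t - f
      lemma = solve-∀ ℚ-ring

    ok-grows : ∀ {c} → ChargeOK θ t₀ σ c → ChargeOK θ t₀ σ′ c
    ok-grows ok = record
      { begun   = let y , y∈ , q = begun in y , there y∈ , q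
      ; opt-dur = opt-dur
      ; window  = λ z∈ q → let a , b , d = window z∈ q in a , b , ≤-trans d (<⇒≤ t<e)
      }
      where open ChargeOK ok

    c₀ : Charge
    c₀ = charge k p oid

    c₀-ok : ChargeOK θ t₀ σ′ c₀
    c₀-ok = record
      { begun   = y₀ , here refl , refl , refl
      ; opt-dur = oid-dur
      ; window  = λ z∈ q → let a , b , d = oid-ok z∈ q in a , early b , ≤-trans d (≤-trans fin≤t (<⇒≤ t<e))
      }
      where
      0≤D+B : 0ℚ ≤ D + B
      0≤D+B = 0≤+ (0≤* 0≤6ℚ 0≤B) 0≤B
      -- The offline transmission starts no earlier than `x` arrives, and `claim` bounds how long
      -- before `t₀` that was.
      early : ∀ {u} → arr (req x) ≤ u → ε * (θ * (t₀ - u)) ≤ D + B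
      early {u} a≤u with <⊎≥ u t₀
      ... | inj₂ t₀≤u = ≤-trans (*-nonpos 0≤ε (*-nonpos (<⇒≤ 0<θ) (p-q≤0 t₀≤u))) 0≤D+B
      ... | inj₁ u<t₀ = ≤-trans (*-monoˡ 0≤ε (≤-trans
              (*-monoʳ-≤-nonNeg (t₀ - u) {{nonNegative (0≤diff (<⇒≤ u<t₀))}} θ≤)
              (*-monoˡ (0≤v (req x)) (+-monoʳ-≤ t₀ (neg-antimono-≤ a≤u))))) (claim x∈ θ≤)

    claim′ : ∀ {it} → it ∈ items σ′ → θ ≤ v (req it) → ε * (v (req it) * (t₀ - arr (req it))) ≤ D + B
    claim′ it∈ with settled σ x it∈
    ... | it , it∈′ , inj₁ (_ , refl)     = claim it∈′
    ... | it , it∈′ , inj₂ (_ , _ , refl) = claim it∈′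

    later′ : ∀ {c} → c ∈ new → ∀ {it} → it ∈ items σ′ → cur it ≡ nothing → page (req it) ≡ on c →
             ∀ {z} → z ∈ S → tid z ≡ opt c → en z ≤ arr (req it)
    later′ c∈ it∈ q with settled σ x it∈
    later′ c∈ it∈ q  | it , it∈′ , inj₁ (_ , refl)     = later c∈ it∈′ q
    later′ c∈ it∈ () | it , it∈′ , inj₂ (_ , _ , refl)

    work-step : ∀ ns os → k ∈ ns ⊎ k ∈ os → ∑ (dur H) (map num new) ≤ ∑ (dur H) ns →
      ∑ (dur H) (map num old) ≤ ∑ (dur H) os → e - t₀ ≤ ∑ (dur (y₀ ∷ H)) ns + ∑ (dur (y₀ ∷ H)) os
    work-step ns os k∈ hn ho = begin
      e - t₀                                        ≡⟨ split e t t₀ ⟩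
      (e - t) + (t - t₀)                            ≤⟨ +-monoʳ-≤ (e - t) (≤-trans work (+-mono-≤ hn ho)) ⟩
      (e - t) + (∑ (dur H) ns + ∑ (dur H) os)       ≤⟨ add k∈ ⟩
      ∑ (dur (y₀ ∷ H)) ns + ∑ (dur (y₀ ∷ H)) os ∎
      where
      open ≤-Reasoning
      split : ∀ a b c → a - c ≡ (a - b) + (b - c)
      split = solve-∀ ℚ-ring
      swap : ∀ a b c → a + (b + c) ≡ b + (a + c)
      swap = solve-∀ ℚ-ring
      add : k ∈ ns ⊎ k ∈ os →
        (e - t) + (∑ (dur H) ns + ∑ (dur H) os) ≤ ∑ (dur (y₀ ∷ H)) ns + ∑ (dur (y₀ ∷ H)) os
      add (inj₁ k∈) = ≤-trans (≤-reflexive (sym (+-assoc (e - t) _ _)))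
        (+-mono-≤ (∑dur-∷-∈ y₀ H ns t<e k∈) (∑dur-mono-∷ y₀ H os t<e))
      add (inj₂ k∈) = ≤-trans (≤-reflexive (swap (e - t) (∑ (dur H) ns) (∑ (dur H) os)))
        (+-mono-≤ (∑dur-mono-∷ y₀ H ns t<e) (∑dur-∷-∈ y₀ H os t<e k∈))

    ∑-∷-≥ : ∀ ks → ∑ (dur H) ks ≤ ∑ (dur H) (k ∷ ks)
    ∑-∷-≥ ks = ≤-trans (≤-reflexive (sym (+-identityˡ _))) (+-monoˡ-≤ _ (dur-nonneg H k proper))

    t₀≤e : t₀ ≤ e
    t₀≤e = ≤-trans t₀≤now (<⇒≤ t<e)

    same-page : ∀ {c} → ChargeOK θ t₀ σ c → oid ≡ opt c → p ≡ on c
    same-page ok q = let z , z∈ , i = oid-present in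
      trans (sym (proj₁ (oid-ok z∈ i))) (proj₁ (ChargeOK.window ok z∈ (trans i q)))

    uncovered-late : cur x ≡ nothing → ∀ {it} → page (req it) ≡ p → ¬ Covered t x it → t < arr (req it)
    uncovered-late q {it} pq ¬c = ≰⇒> λ a≤ → ¬c (sym pq , subst (λ m → Joins t m it) (sym q) a≤)

    extend-new : cur x ≡ nothing → Seg θ t₀ σ′
    extend-new q = record
      { new = c₀ ∷ new ; old = old ; t₀≤now = t₀≤e ; claim = claim′
      ; work = work-step (k ∷ map num new) (map num old) (inj₁ (here refl)) (∑-∷-≥ (map num new)) ≤-refl
      ; new-ok = λ { (here refl) → c₀-ok ; (there c∈) → ok-grows (new-ok c∈) }
      ; old-ok = λ c∈ → ok-grows (old-ok c∈)
      ; new-uniq = All.tabulate distinct ∷ new-uniq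
      ; old-uniq = old-uniq
      ; later = λ { (here refl) → later₀ ; (there c∈) → later′ c∈ }
      ; taken = taken′
      ; np-old = np-old }
      where
      -- A common transmission would have a piece that ends before `x` arrives and starts after
      -- that.
      distinct : ∀ {o} → o ∈ map opt new → oid ≢ o
      distinct o∈ r with ∈-map⁻ opt o∈
      ... | c , c∈ , refl = let z , z∈ , i = oid-present in
        <-irrefl refl (<-≤-trans (S-proper z∈)
          (≤-trans (later c∈ x∈ q (same-page (new-ok c∈) r) z∈ (trans i r))
                   (proj₁ (proj₂ (oid-ok z∈ i)))))
      -- A request for the page that the fresh transmission leaves out arrives after `t`, hence
      -- after `fin`.
      later₀ : ∀ {it} → it ∈ items σ′ → cur it ≡ nothing → page (req it) ≡ p →
               ∀ {z} → z ∈ S → tid z ≡ oid → en z ≤ arr (req it)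
      later₀ it∈ n pq z∈ i with settled σ x it∈
      later₀ it∈ n pq z∈ i  | it , it∈′ , inj₁ (¬c , refl) =
        ≤-trans (proj₂ (proj₂ (oid-ok z∈ i))) (≤-trans fin≤t (<⇒≤ (uncovered-late q pq ¬c)))
      later₀ it∈ () pq z∈ i | it , it∈′ , inj₂ (_ , _ , refl)
      taken′ : ∀ {c} → c ∈ old → ∀ {it k′ w} → it ∈ items σ′ → page (req it) ≡ on c → cur it ≡ just (k′ , w) →
               k′ ≡ num c ⊎ k′ ∈ k ∷ map num new
      taken′ c∈ it∈ pq j with settled σ x it∈
      taken′ c∈ it∈ pq refl | it , it∈′ , inj₂ (_ , _ , refl) = inj₂ (here refl)
      taken′ c∈ it∈ pq j    | it , it∈′ , inj₁ (_ , refl) with taken c∈ it∈′ pq j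
      ... | inj₁ a = inj₁ a
      ... | inj₂ b = inj₂ (there b)

    transmission-just : ∀ {n k′ w′} x → cur x ≡ just (k′ , w′) → transmission n x ≡ k′
    transmission-just (item J (just _)) refl = refl

    covered-cur : ∀ {kw} → cur x ≡ just kw → ∀ {it} → Covered t x it → ∃[ kw′ ] (cur it ≡ just kw′)
    covered-cur j {it} (_ , c) = is-just-inv (cur it) (subst (λ m → Joins t m it) j c)

    taken-cont : ∀ {kw} → cur x ≡ just kw → ∀ {c} → c ∈ old →
      ∀ {it k′ w} → it ∈ items σ′ → page (req it) ≡ on c → cur it ≡ just (k′ , w) →
      k′ ≡ num c ⊎ k′ ∈ map num new
    taken-cont j c∈ it∈ pq q with settled σ x it∈
    taken-cont j c∈ it∈ pq q    | it , it∈′ , inj₁ (_ , refl) = taken c∈ it∈′ pq q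
    taken-cont j c∈ it∈ pq refl | it , it∈′ , inj₂ (c , _ , refl) with covered-cur j c
    ... | _ , q = subst (λ k → k ≡ _ ⊎ k ∈ map num new)
                    (trans (sym (unique x∈ it∈′ (proj₁ c) j q)) (sym (transmission-just x j))) (taken c∈ it∈′ pq q)

    extend-same : ∀ {kw} → cur x ≡ just kw → k ∈ map num new ⊎ k ∈ map num old → Seg θ t₀ σ′
    extend-same j k∈ = record
      { new = new ; old = old ; t₀≤now = t₀≤e ; claim = claim′
      ; work = work-step (map num new) (map num old) k∈ ≤-refl ≤-refl
      ; new-ok = λ c∈ → ok-grows (new-ok c∈)
      ; old-ok = λ c∈ → ok-grows (old-ok c∈)
      ; new-uniq = new-uniq ; old-uniq = old-uniq
      ; later = later′
      ; taken = taken-cont j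
      ; np-old = np-old }

    extend-old : ∀ {kw} → cur x ≡ just kw → k ∉ map num new → k ∉ map num old → Seg θ t₀ σ′
    extend-old {kw} j k∉new k∉old = record
      { new = new ; old = c₀ ∷ old ; t₀≤now = t₀≤e ; claim = claim′
      ; work = work-step (map num new) (k ∷ map num old) (inj₂ (here refl)) ≤-refl (∑-∷-≥ (map num old))
      ; new-ok = λ c∈ → ok-grows (new-ok c∈)
      ; old-ok = λ { (here refl) → c₀-ok ; (there c∈) → ok-grows (old-ok c∈) }
      ; new-uniq = new-uniq
      ; old-uniq = All.tabulate distinct ∷ old-uniq
      ; later = later′
      ; taken = λ { (here refl) → taken₀ ; (there c∈) → taken-cont j c∈ }
      ; np-old = λ np → contradiction (trans (sym j) (np-nothing np)) λ () }
      where
      -- Equal offline transmissions have equal pages, and then `taken` puts `k` into one of the two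
      -- lists already.
      distinct : ∀ {o} → o ∈ map opt old → oid ≢ o
      distinct o∈ r with ∈-map⁻ opt o∈
      ... | c , c∈ , refl with taken c∈ x∈ (same-page (old-ok c∈) r) j
      ...   | inj₁ a = k∉old (subst (_∈ map num old) (trans (sym a) (sym (transmission-just x j))) (∈-map⁺ num c∈))
      ...   | inj₂ b = k∉new (subst (_∈ map num new) (sym (transmission-just x j)) b)
      taken₀ : ∀ {it k′ w} → it ∈ items σ′ → page (req it) ≡ p → cur it ≡ just (k′ , w) →
               k′ ≡ k ⊎ k′ ∈ map num new
      taken₀ it∈ pq q with settled σ x it∈
      taken₀ it∈ pq q    | it , it∈′ , inj₁ (¬c , refl) = contradiction (covers it∈′ (sym pq) q) ¬c
      taken₀ it∈ pq refl | it , it∈′ , inj₂ (_ , _ , refl) = inj₁ refl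

    extend : Seg θ t₀ σ′
    extend = go (cur x) refl (k ∈? map num new) (k ∈? map num old)
      where
      go : ∀ m → cur x ≡ m → Dec (k ∈ map num new) → Dec (k ∈ map num old) → Seg θ t₀ σ′
      go nothing  q _        _        = extend-new q
      go (just _) q (yes k∈) _        = extend-same q (inj₁ k∈)
      go (just _) q (no _)   (yes k∈) = extend-same q (inj₂ k∈)
      go (just _) q (no k∉)  (no k∉′) = extend-old q k∉ k∉′

  Response : ℚ → Request → Set
  Response f J = ε * (ε * (v J * (f - arr J))) ≤ 6ℚ * D

  record Good (σ : State) : Set where
    field
      inv   : Inv σ
      opts  : ∀ {it} → it ∈ items σ → Opt (req it)
      waits : ∀ {it} → it ∈ items σ → arr (req it) ≤ now σ → Response (now σ) (req it)
      segs  : ∀ {θ} → 0ℚ < θ → ∃[ t₀ ] Seg θ t₀ σ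

  module _ (σ : State) (x : Item) (good : Good σ) (sel : Selected (now σ) (items σ) x) where
    open Good good
    open Selected sel
    open Serve σ x inv member present

    private
      t = now σ
      e = stop σ x

    0≤B : 0ℚ ≤ B
    0≤B = Opt.0≤B (opts member)

    0≤D : 0ℚ ≤ D
    0≤D = 0≤* 0≤6ℚ 0≤B

    B≤D : B ≤ D
    B≤D = ≤-trans (≤-reflexive (sym (*-identityˡ B))) (*-monoʳ-≤-nonNeg B {{nonNegative 0≤B}} 1≤6ℚ)

    0≤D+B : 0ℚ ≤ D + B
    0≤D+B = 0≤+ 0≤D 0≤B

    6D≡ : 6ℚ * D ≡ ((D + D) + D) + ((D + D) + D)
    6D≡ = lemma D
      where
      lemma : ∀ d → 6ℚ * d ≡ ((d + d) + d) + ((d + d) + d)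
      lemma = solve-∀ ℚ-ring

    3[D+B]≤6D : ((D + B) + (D + B)) + (D + B) ≤ 6ℚ * D
    3[D+B]≤6D = ≤-trans (+-mono-≤ (+-mono-≤ D+B≤ D+B≤) D+B≤) (≤-reflexive (trans (lemma D) (sym 6D≡)))
      where
      D+B≤ : D + B ≤ D + D
      D+B≤ = +-monoʳ-≤ D B≤D
      lemma : ∀ d → ((d + d) + (d + d)) + (d + d) ≡ ((d + d) + d) + ((d + d) + d)
      lemma = solve-∀ ℚ-ring

    D+B≤6D : D + B ≤ 6ℚ * D
    D+B≤6D = ≤-trans (≤-diff ((D + B) + (D + B)) (0≤+ 0≤D+B 0≤D+B) (lemma (D + B))) 3[D+B]≤6D
      where
      lemma : ∀ d → d + d ≡ ((d + d) + d) - d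
      lemma = solve-∀ ℚ-ring

    shrink : ∀ {q b} → 0ℚ ≤ b → q ≤ b → ε * q ≤ b
    shrink 0≤b q≤b = ≤-trans (*-monoˡ 0≤ε q≤b) (scale≤ 0≤ε ε≤1 0≤b)

    v*step≤B : ∀ {it} → it ∈ items σ → arr (req it) < e → v (req it) * (e - t) ≤ B
    v*step≤B it∈ a<e = Opt.v*[·]≤B (opts it∈) (e-short it∈ a<e)

    -- The split is at ε·wait = `D`. Below it, the step adds at most `B`. Above it, the item itself
    -- is urgent and competes with `x`.
    urgent-or-recent : ∀ {it} → it ∈ items σ →
      (arr (req it) ≤ t × v (req it) ≤ v (req x) × B ≤ wait t x) ⊎ ε * (v (req it) * (e - arr (req it))) ≤ D + B
    urgent-or-recent {it} it∈ with <⊎≥ t (arr (req it))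
    ... | inj₁ t<a with <⊎≥ (arr (req it)) e
    ...   | inj₂ e≤a = inj₂ (≤-trans (*-nonpos 0≤ε (*-nonpos (0≤v (req it)) (p-q≤0 e≤a))) 0≤D+B)
    ...   | inj₁ a<e = inj₂ (≤-trans (shrink 0≤B (≤-trans
              (*-monoˡ (0≤v (req it)) (+-monoʳ-≤ e (neg-antimono-≤ (<⇒≤ t<a)))) (v*step≤B it∈ a<e)))
              (≤-diff D 0≤D (lemma D B)))
      where
      lemma : ∀ d b → d ≡ (d + b) - b
      lemma = solve-∀ ℚ-ring
    urgent-or-recent {it} it∈ | inj₂ a≤t with <⊎≥ (ε * wait t it) D
    ... | inj₁ w<D = inj₂ (≤-trans (≤-reflexive (lemma ε (v (req it)) e t (arr (req it))))
            (+-mono-≤ (<⇒≤ w<D) (shrink 0≤B (v*step≤B it∈ (≤-<-trans a≤t t<e)))))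
      where
      lemma : ∀ ε v e t a → ε * (v * (e - a)) ≡ ε * (v * (t - a)) + ε * (v * (e - t))
      lemma = solve-∀ ℚ-ring
    ... | inj₂ D≤w = inj₁ (a≤t , best it∈ a≤t is-urgent ,
            -- `D` is 6B, so the factor 6 of the urgency test cancels.
            *-cancelˡ {6ℚ} (positive⁻¹ 6ℚ) (≤-trans D≤w (urgent it∈ a≤t)))
      where
      swap : ∀ a b → 6ℚ * (a * b) ≡ a * (6ℚ * b)
      swap = solve-∀ ℚ-ring
      -- The induction hypothesis enters: ε²·wait of `a` ≤ 6D ≤ 6ε·wait of `it`, and ε cancels.
      is-urgent : ∀ {a} → a ∈ items σ → arr (req a) ≤ t → ε * wait t a ≤ 6ℚ * wait t it
      is-urgent {a} a∈ a≤ = *-cancelˡ 0<ε (≤-trans (waits a∈ a≤)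
        (≤-trans (*-monoˡ 0≤6ℚ D≤w) (≤-reflexive (swap ε (wait t it)))))

    extended : ∀ {θ t₀} → 0ℚ < θ → θ ≤ v (req x) → B ≤ wait t x → Seg θ t₀ σ → Seg θ t₀ (serve σ x)
    extended 0<θ θ≤ B≤ = Extend.extend 0<θ σ x inv member present (opts member) θ≤ B≤

    -- The wait is split at the start `t₀` of the segment for the item's own weight: `segment-short`
    -- gives 2(D + B) for the part after `t₀`, and `claim` gives D + B for the part before.
    response : ∀ {it} → it ∈ items σ → Response e (req it)
    response {it} it∈ with urgent-or-recent it∈
    ... | inj₂ recent = ≤-trans (shrink 0≤D+B recent) D+B≤6D
    ... | inj₁ (a≤t , v≤ , B≤) with <⊎≥ 0ℚ (v (req it))
    ...   | inj₂ v≤0 = ≤-trans (*-nonpos 0≤ε (*-nonpos 0≤ε nonpos)) (0≤* 0≤6ℚ 0≤D)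
      where
      nonpos : v (req it) * (e - arr (req it)) ≤ 0ℚ
      nonpos = ≤-trans (≤-reflexive (*-comm (v (req it)) (e - arr (req it)))) (*-nonpos (0≤diff (≤-trans a≤t (<⇒≤ t<e))) v≤0)
    ...   | inj₁ 0<v = begin
      ε * (ε * (θ * (e - a)))
        ≡⟨ lemma ε θ e t₀ a ⟩
      ε * (θ * (ε * (e - t₀))) + ε * (ε * (θ * (t₀ - a)))
        ≤⟨ +-mono-≤ (segment-short 0<v (serve σ x) inv′ seg′ 0≤B) (shrink 0≤D+B (Seg.claim seg it∈ ≤-refl)) ⟩
      ((D + B) + (D + B)) + (D + B)
        ≤⟨ 3[D+B]≤6D ⟩
      6ℚ * D ∎
      where
      open ≤-Reasoning
      θ = v (req it)
      a = arr (req it)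
      t₀ = proj₁ (segs 0<v)
      seg : Seg θ t₀ σ
      seg = proj₂ (segs 0<v)
      seg′ : Seg θ t₀ (serve σ x)
      seg′ = extended 0<v v≤ B≤ seg
      lemma : ∀ ε θ e t₀ a → ε * (ε * (θ * (e - a))) ≡ ε * (θ * (ε * (e - t₀))) + ε * (ε * (θ * (t₀ - a)))
      lemma = solve-∀ ℚ-ring

    serve-good : Good (serve σ x)
    serve-good = record
      { inv   = inv′
      ; opts  = opts′
      ; waits = λ it∈ _ → let it , it∈′ , q = same-req it∈ in subst (Response e) (sym q) (response it∈′)
      ; segs  = segs′
      }
      where
      same-req : ∀ {it′} → it′ ∈ items (serve σ x) → ∃[ it ] (it ∈ items σ × req it′ ≡ req it)
      same-req it∈ with settled σ x it∈
      ... | it , it∈′ , inj₁ (_ , refl)     = it , it∈′ , refl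
      ... | it , it∈′ , inj₂ (_ , _ , refl) = it , it∈′ , refl
      opts′ : ∀ {it} → it ∈ items (serve σ x) → Opt (req it)
      opts′ it∈ = let it , it∈′ , q = same-req it∈ in subst Opt (sym q) (opts it∈′)
      -- If `x` is lighter than θ or its weighted wait is below `B`, then no request of weight at
      -- least θ falls into the first case of `urgent-or-recent`.
      reset : ∀ {θ} → ¬ (θ ≤ v (req x) × B ≤ wait t x) → Seg θ e (serve σ x)
      reset {θ} bad = new-segment θ (serve σ x) h
        where
        h : ∀ {it} → it ∈ items (serve σ x) → θ ≤ v (req it) → ε * (v (req it) * (e - arr (req it))) ≤ D + B
        h it∈ θ≤ with same-req it∈
        ... | it , it∈′ , q with urgent-or-recent it∈′
        ...   | inj₂ recent = subst (λ J → ε * (v J * (e - arr J)) ≤ D + B) (sym q) recent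
        ...   | inj₁ (_ , v≤ , B≤) = contradiction (≤-trans θ≤ (subst (λ J → v J ≤ v (req x)) (sym q) v≤) , B≤) bad
      segs′ : ∀ {θ} → 0ℚ < θ → ∃[ t₀ ] Seg θ t₀ (serve σ x)
      segs′ {θ} 0<θ with (θ ≤? v (req x)) ×-dec (B ≤? wait t x)
      ... | yes (θ≤ , B≤) = proj₁ (segs 0<θ) , extended 0<θ θ≤ B≤ (proj₂ (segs 0<θ))
      ... | no bad        = e , reset bad

  -- At the first arrival nothing has waited yet, so every segment can restart.
  arrival-good : ∀ {σ} → Inv σ → (∀ {it} → it ∈ items σ → Opt (req it)) →
    (∀ {it} → it ∈ items σ → now σ ≤ arr (req it)) → Good σ
  arrival-good {σ} inv opts first = record
    { inv   = inv
    ; opts  = opts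
    ; waits = λ {it} it∈ _ → ≤-trans (*-nonpos 0≤ε (recent {it} it∈)) (0≤* {6ℚ} {D} 0≤6ℚ (0≤* {6ℚ} {B} 0≤6ℚ (Opt.0≤B (opts it∈))))
    ; segs  = λ {θ} _ → now σ , new-segment θ σ λ {it} it∈ _ → ≤-trans (recent {it} it∈)
                (0≤+ {D} (0≤* {6ℚ} {B} 0≤6ℚ (Opt.0≤B (opts it∈))) (Opt.0≤B (opts it∈)))
    }
    where
    recent : ∀ {it} → it ∈ items σ → ε * (v (req it) * (now σ - arr (req it))) ≤ 0ℚ
    recent {it} it∈ = *-nonpos 0≤ε (*-nonpos (0≤v (req it)) (p-q≤0 (first it∈)))

  Met : State → Request → Set
  Met σ J = (∃[ it ] (it ∈ items σ × req it ≡ J)) ⊎ (∃[ f ] (Finished (pieces σ) J f × Response f J))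

  step-good : ∀ σ → Good σ → Good (step σ)
  step-good σ good with step σ | step-view σ
  ... | _ | idled none halted = good
  ... | _ | idled none iv@(waited t′ (_ , first)) =
    arrival-good (idle-inv (Good.inv good) none iv) (Good.opts good) first
  ... | _ | served x sel = serve-good σ x good sel

  step-met : ∀ σ {J} → Good σ → Met σ J → Met (step σ) J
  step-met σ {J} good met with step σ | step-view σ | met
  ... | _ | idled none halted       | m = m
  ... | _ | idled none (waited _ _) | m = m
  ... | _ | served x sel | inj₂ (f , fin , ok) =
    inj₂ (f , Serve.finished-later σ x (Good.inv good) (Selected.member sel) (Selected.present sel) {J} fin , ok)
  ... | _ | served x sel | inj₁ (it , it∈ , refl) with pending-or-done σ x it∈
  ...   | inj₂ (it′ , it′∈ , q) = inj₁ (it′ , it′∈ , q)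
  ...   | inj₁ (c , done) = inj₂ (stop σ x ,
          Serve.finished-now σ x (Good.inv good) (Selected.member sel) (Selected.present sel) it∈ c done ,
          response σ x good sel it∈)

  initial-good : ∀ I → (∀ {J} → J ∈ I → Opt J) → Good (initial I)
  initial-good I opts = good (idle-view σ₀) opts₀ (initial-inv I)
    where
    σ₀ = state 0ℚ 0 (map waiting I) []
    opts₀ : ∀ {it} → it ∈ items σ₀ → Opt (req it)
    opts₀ it∈ with ∈-map⁻ _ it∈
    ... | J , J∈ , refl = opts J∈
    good : ∀ {σ σ′} → IdleView σ σ′ → (∀ {it} → it ∈ items σ → Opt (req it)) → Inv σ′ → Good σ′
    good halted                opts inv = arrival-good inv opts λ ()
    good (waited t (_ , first)) opts inv = arrival-good inv opts first

  initial-met : ∀ I {J} → J ∈ I → Met (initial I) J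
  initial-met I {J} J∈ = inj₁ (pending (idle-view _) (∈-map⁺ waiting J∈))
    where
    pending : ∀ {σ σ′} → IdleView σ σ′ → item J nothing ∈ items σ → ∃[ it ] (it ∈ items σ′ × req it ≡ J)
    pending halted       it∈ = _ , it∈ , refl
    pending (waited _ _) it∈ = _ , it∈ , refl

  run-good : ∀ N σ → Good σ → Good (run N σ)
  run-good ℕ.zero    σ good = good
  run-good (ℕ.suc N) σ good = run-good N (step σ) (step-good σ good)

  run-met : ∀ N σ {J} → Good σ → Met σ J → Met (run N σ) J
  run-met ℕ.zero    σ good met = met
  run-met (ℕ.suc N) σ good met = run-met N (step σ) (step-good σ good) (step-met σ good met)

-- Onlineness

activeAt-skip : ∀ x S {τ} → τ < st x → activeAt (x ∷ S) τ ≡ activeAt S τ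
activeAt-skip x S {τ} τ<st with st x ≤? τ | τ <? en x
... | yes st≤τ | _     = ⊥-elim (<-irrefl refl (<-≤-trans τ<st st≤τ))
... | no _     | yes _ = refl
... | no _     | no _  = refl

activeAt-hit : ∀ x S {τ} → st x ≤ τ → τ < en x → activeAt (x ∷ S) τ ≡ just (pg x , tid x)
activeAt-hit x S {τ} st≤τ τ<en with st x ≤? τ | τ <? en x
... | yes _ | yes _ = refl
... | yes _ | no ¬p = contradiction τ<en ¬p
... | no ¬p | _     = contradiction st≤τ ¬p

-- For the next events of two runs that agree up to `τ`: an event by `τ` in one run bounds the event
-- of the other.
equal-or-later : ∀ {τ e e′} → (e ≤ τ → e′ ≤ e) → (e′ ≤ τ → e ≤ e′) → e ≡ e′ ⊎ (τ < e × τ < e′)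
equal-or-later {τ} {e} {e′} f g with <⊎≥ τ e | <⊎≥ τ e′
... | inj₁ τ<e | inj₁ τ<e′ = inj₂ (τ<e , τ<e′)
... | inj₂ e≤τ | _         = inj₁ (≤-antisym (g (≤-trans (f e≤τ) e≤τ)) (f e≤τ))
... | inj₁ τ<e | inj₂ e′≤τ = ⊥-elim (<-irrefl refl (<-≤-trans τ<e (≤-trans (g e′≤τ) e′≤τ)))

arrived-yes : ∀ {τ i is} → arr (req i) ≤ τ → arrived τ (i ∷ is) ≡ i ∷ arrived τ is
arrived-yes {τ} {i} {is} = filter-accept {P = λ it → arr (req it) ≤ τ} (λ it → arr (req it) ≤? τ) {i} {is}

arrived-no : ∀ {τ i is} → ¬ (arr (req i) ≤ τ) → arrived τ (i ∷ is) ≡ arrived τ is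
arrived-no {τ} {i} {is} = filter-reject {P = λ it → arr (req it) ≤ τ} (λ it → arr (req it) ≤? τ) {i} {is}

arrived-mapMaybe : ∀ τ (f : Item → Maybe Item) → (∀ it {it′} → f it ≡ just it′ → req it′ ≡ req it) →
  ∀ is → arrived τ (mapMaybe f is) ≡ mapMaybe f (arrived τ is)
arrived-mapMaybe τ f keeps [] = refl
arrived-mapMaybe τ f keeps (i ∷ is) = go (f i) refl (arr (req i) ≤? τ)
  where
  ih : arrived τ (mapMaybe f is) ≡ mapMaybe f (arrived τ is)
  ih = arrived-mapMaybe τ f keeps is
  mapMaybe-∷ : ∀ {m} xs → f i ≡ m → mapMaybe f (i ∷ xs) ≡ maybe′ (_∷ mapMaybe f xs) (mapMaybe f xs) m
  mapMaybe-∷ xs q with f i | q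
  ... | just _  | refl = refl
  ... | nothing | refl = refl
  go : ∀ m → f i ≡ m → Dec (arr (req i) ≤ τ) → arrived τ (mapMaybe f (i ∷ is)) ≡ mapMaybe f (arrived τ (i ∷ is))
  go nothing q (yes a) = trans (cong (arrived τ) (mapMaybe-∷ is q))
    (trans ih (sym (trans (cong (mapMaybe f) (arrived-yes a)) (mapMaybe-∷ (arrived τ is) q))))
  go nothing q (no ¬a) = trans (cong (arrived τ) (mapMaybe-∷ is q))
    (trans ih (sym (cong (mapMaybe f) (arrived-no ¬a))))
  go (just j) q (yes a) = trans (cong (arrived τ) (mapMaybe-∷ is q))
    (trans (arrived-yes (subst (λ J → arr J ≤ τ) (sym (keeps i q)) a))
    (trans (cong (j ∷_) ih) (sym (trans (cong (mapMaybe f) (arrived-yes a)) (mapMaybe-∷ (arrived τ is) q)))))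
  go (just j) q (no ¬a) = trans (cong (arrived τ) (mapMaybe-∷ is q))
    (trans (arrived-no (¬a ∘ subst (λ J → arr J ≤ τ) (keeps i q)))
    (trans ih (sym (cong (mapMaybe f) (arrived-no ¬a)))))

arrived-arrived : ∀ {t τ} → t ≤ τ → ∀ is → arrived t (arrived τ is) ≡ arrived t is
arrived-arrived t≤τ [] = refl
arrived-arrived {t} {τ} t≤τ (i ∷ is) = go (arr (req i) ≤? τ) (arr (req i) ≤? t)
  where
  ih : arrived t (arrived τ is) ≡ arrived t is
  ih = arrived-arrived t≤τ is
  go : Dec (arr (req i) ≤ τ) → Dec (arr (req i) ≤ t) → arrived t (arrived τ (i ∷ is)) ≡ arrived t (i ∷ is)
  go (yes a) (yes b) = trans (cong (arrived t) (arrived-yes a))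
    (trans (arrived-yes b) (trans (cong (i ∷_) ih) (sym (arrived-yes b))))
  go (yes a) (no ¬b) = trans (cong (arrived t) (arrived-yes a))
    (trans (arrived-no ¬b) (trans ih (sym (arrived-no ¬b))))
  go (no ¬a) (yes b) = contradiction (≤-trans b t≤τ) ¬a
  go (no ¬a) (no ¬b) = trans (cong (arrived t) (arrived-no ¬a)) (trans ih (sym (arrived-no ¬b)))

arrived-map : ∀ τ I → arrived τ (map waiting I) ≡ map waiting (arrivedBy τ I)
arrived-map τ [] = refl
arrived-map τ (J ∷ I) = go (arr J ≤? τ)
  where
  go : Dec (arr J ≤ τ) → arrived τ (map waiting (J ∷ I)) ≡ map waiting (arrivedBy τ (J ∷ I))
  go (yes a) = trans (arrived-yes a) (trans (cong (waiting J ∷_) (arrived-map τ I))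
    (sym (cong (map waiting) (filter-accept {P = λ J → arr J ≤ τ} (λ J → arr J ≤? τ) {xs = I} a))))
  go (no ¬a) = trans (arrived-no ¬a) (trans (arrived-map τ I)
    (sym (cong (map waiting) (filter-reject {P = λ J → arr J ≤ τ} (λ J → arr J ≤? τ) {xs = I} ¬a))))

arrived-transfer : ∀ {τ is is′ it} → arrived τ is ≡ arrived τ is′ → it ∈ is → arr (req it) ≤ τ → it ∈ is′
arrived-transfer {τ} {is} {is′} eq it∈ a≤ = proj₁ (∈-filter⁻ _ {xs = is′} (subst (_ ∈_) eq (∈-filter⁺ _ it∈ a≤)))

module Onlineness
  (mode : Mode) (s r ε : ℚ) (ℓ : Lengths) (v : Request → ℚ)
  (0<s : 0ℚ < s) (0<r : 0ℚ < r) (s*r≡1 : s * r ≡ 1ℚ) (0<ℓ : ∀ p → 0ℚ < ℓ p)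
  (short : mode ≡ nonPreemptive → ∀ p q → ℓ p * r ≤ ℓ q)
  (0<ε : 0ℚ < ε) (ε≤1 : ε ≤ 1ℚ) (0≤v : ∀ J → 0ℚ ≤ v J)
  where

  open Views mode s r ε ℓ v 0<s 0<r s*r≡1 0<ℓ short 0<ε ε≤1 0≤v public

  Dead : ℚ → State → Set
  Dead τ σ = τ < now σ ⊎ items σ ≡ []

  -- Runs on two instances go in lockstep until their clocks pass `τ` or a run has no items left.
  -- After that any new piece starts after `τ` and cannot change `activeAt` at `τ`.
  data Sim (τ : ℚ) : State → State → Set where
    synced : ∀ {t n is is′ H} → t ≤ τ → arrived τ is ≡ arrived τ is′ → Sim τ (state t n is H) (state t n is′ H)
    parted : ∀ {σ σ′} → activeAt (pieces σ) τ ≡ activeAt (pieces σ′) τ → Dead τ σ → Dead τ σ′ → Sim τ σ σ′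

  sim-active : ∀ {τ σ σ′} → Sim τ σ σ′ → activeAt (pieces σ) τ ≡ activeAt (pieces σ′) τ
  sim-active (synced _ _)    = refl
  sim-active (parted eq _ _) = eq

  step-dead : ∀ {τ} σ → Inv σ → Dead τ σ → Dead τ (step σ) × activeAt (pieces (step σ)) τ ≡ activeAt (pieces σ) τ
  step-dead {τ} σ inv dead with step σ | step-view σ | dead
  ... | _ | idled none halted                               | d = d , refl
  ... | _ | idled none (waited _ ((it , it∈ , refl) , _))   | inj₁ τ<t = inj₁ (<-trans τ<t (none it∈)) , refl
  ... | _ | idled none (waited _ _)                         | inj₂ e = inj₂ e , refl
  ... | _ | served x sel | inj₂ e = contradiction (subst (x ∈_) e (Selected.member sel)) λ ()
  ... | _ | served x sel | inj₁ τ<t =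
    inj₁ (<-trans τ<t (Serve.t<e σ x inv (Selected.member sel) (Selected.present sel))) ,
    activeAt-skip (piece σ x) (pieces σ) τ<t

  idle-sim : ∀ {τ t n is is′ H σ σ′} → arrived τ is ≡ arrived τ is′ →
    IdleView (state t n is H) σ → IdleView (state t n is′ H) σ′ → Sim τ σ σ′
  idle-sim eq halted halted = parted refl (inj₂ refl) (inj₂ refl)
  idle-sim {τ} eq halted (waited t′ ((it , it∈ , refl) , _)) = parted refl (inj₂ refl) (inj₁ (≰⇒> λ a≤ →
    contradiction (arrived-transfer {is′ = []} (sym eq) it∈ a≤) λ ()))
  idle-sim {τ} eq (waited t′ ((it , it∈ , refl) , _)) halted = parted refl (inj₁ (≰⇒> λ a≤ →
    contradiction (arrived-transfer {is′ = []} eq it∈ a≤) λ ())) (inj₂ refl)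
  idle-sim {τ} {_} {n} {is} {is′} {H} eq (waited t ((it , it∈ , refl) , least)) (waited t′ ((it′ , it′∈ , refl) , least′))
    with equal-or-later {τ} {t} {t′} (λ a≤ → least′ (arrived-transfer eq it∈ a≤)) (λ a≤ → least (arrived-transfer (sym eq) it′∈ a≤))
  ... | inj₂ (τ<t , τ<t′) = parted refl (inj₁ τ<t) (inj₁ τ<t′)
  ... | inj₁ t≡t′ with <⊎≥ τ t
  ...   | inj₁ τ<t = parted refl (inj₁ τ<t) (inj₁ (subst (τ <_) t≡t′ τ<t))
  ...   | inj₂ t≤τ = subst (λ u → Sim τ (state t n is H) (state u n is′ H)) t≡t′ (synced t≤τ eq)

  -- A stop by `τ` is due to completion or to an item that has arrived by `τ`; the other run has the
  -- same cause and stops no later.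
  stopAt-agree : ∀ m {τ t w is is′} → t ≤ τ → arrived τ is ≡ arrived τ is′ →
    stopAt m t w is ≤ τ → stopAt m t w is′ ≤ stopAt m t w is
  stopAt-agree nonPreemptive t≤τ eq e≤τ = ≤-refl
  stopAt-agree preemptive {τ} {t} {w} {is} {is′} t≤τ eq e≤τ with stopAt-sel preemptive t w is
  ... | inj₁ e = ≤-trans (stopAt-≤full preemptive t w is′) (≤-reflexive (sym e))
  ... | inj₂ (it , it∈ , e) = ≤-trans (stopAt-≤bound t w {is′} (arrived-transfer eq it∈ known)) (≤-reflexive (sym e))
    where
    known : arr (req it) ≤ τ
    known with <⊎≥ t (arr (req it))
    ... | inj₂ a≤t = ≤-trans a≤t t≤τ
    ... | inj₁ t<a = ≤-trans (≤-reflexive (sym (trans e (bound-future t it t<a)))) e≤τ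

  settle-keeps : ∀ t x k w it {it′} → settle t x k w it ≡ just it′ → req it′ ≡ req it
  settle-keeps t x k w it q with settle-cases t x k w it q
  ... | inj₁ (_ , refl)     = refl
  ... | inj₂ (_ , _ , refl) = refl

  serve-sim : ∀ {τ t n is is′ H} x → t ≤ τ → arrived τ is ≡ arrived τ is′ →
    Sim τ (serve (state t n is H) x) (serve (state t n is′ H) x)
  serve-sim {τ} {t} {n} {is} {is′} {H} x t≤τ eq
    with equal-or-later {τ} {stop (state t n is H) x} {stop (state t n is′ H) x}
           (stopAt-agree mode t≤τ eq) (stopAt-agree mode t≤τ (sym eq))
  -- The pieces may end at different times, but at `τ` both carry the same transmission.
  ... | inj₂ (τ<e , τ<e′) = parted
    (trans (activeAt-hit (piece (state t n is H) x) H t≤τ τ<e) (sym (activeAt-hit (piece (state t n is′ H) x) H t≤τ τ<e′)))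
    (inj₁ τ<e) (inj₁ τ<e′)
  ... | inj₁ e≡e′ = subst (λ u → Sim τ (serve (state t n is H) x) (after is′ u)) e≡e′ (go (<⊎≥ τ e))
    where
    e = stop (state t n is H) x
    k = transmission n x
    -- The resulting state as a function of the end time, so that `e≡e′` can be substituted.
    after : List Item → ℚ → State
    after js u = state u (fresh n x) (mapMaybe (settle t x k (amount x - s * (u - t))) js)
      (record { pg = page (req x) ; tid = k ; st = t ; en = u } ∷ H)
    go : τ < e ⊎ e ≤ τ → Sim τ (after is e) (after is′ e)
    go (inj₁ τ<e) = parted refl (inj₁ τ<e) (inj₁ τ<e)
    go (inj₂ e≤τ) = synced e≤τ (trans (arrived-mapMaybe τ _ (settle-keeps t x k _) is)
      (trans (cong (mapMaybe _) eq) (sym (arrived-mapMaybe τ _ (settle-keeps t x k _) is′))))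

  step-sim : ∀ {τ σ σ′} → Inv σ → Inv σ′ → Sim τ σ σ′ → Sim τ (step σ) (step σ′)
  step-sim inv inv′ (parted eq d d′) =
    let d₁ , q = step-dead _ inv d ; d₁′ , q′ = step-dead _ inv′ d′ in parted (trans q (trans eq (sym q′))) d₁ d₁′
  step-sim {τ} inv inv′ (synced {t} {n} {is} {is′} {H} t≤τ eq) =
    subst (λ as → Sim τ (stepOn (state t n is H) (arrived t is)) (stepOn (state t n is′ H) as)) same-arrived (go (arrived t is))
    where
    same-arrived : arrived t is ≡ arrived t is′
    same-arrived = trans (sym (arrived-arrived t≤τ is)) (trans (cong (arrived t) eq) (arrived-arrived t≤τ is′))
    go : ∀ as → Sim τ (stepOn (state t n is H) as) (stepOn (state t n is′ H) as)
    go []       = idle-sim eq (idle-view (state t n is H)) (idle-view (state t n is′ H))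
    go (a ∷ as) = serve-sim (pick t a as) t≤τ eq

  run-sim : ∀ N {τ σ σ′} → Inv σ → Inv σ′ → Sim τ σ σ′ → Sim τ (run N σ) (run N σ′)
  run-sim ℕ.zero    inv inv′ sim = sim
  run-sim (ℕ.suc N) inv inv′ sim = run-sim N (step-inv _ inv) (step-inv _ inv′) (step-sim inv inv′ sim)

  run-inv : ∀ N σ → Inv σ → Inv (run N σ)
  run-inv ℕ.zero    σ inv = inv
  run-inv (ℕ.suc N) σ inv = run-inv N (step σ) (step-inv σ inv)

  initial-sim : ∀ {τ I I′} → arrivedBy τ I ≡ arrivedBy τ I′ → Sim τ (initial I) (initial I′)
  initial-sim {τ} {I} {I′} eq = idle-sim
    (trans (arrived-map τ I) (trans (cong (map waiting) eq) (sym (arrived-map τ I′)))) (idle-view _) (idle-view _)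

  run-+ : ∀ M N σ → run (M Nat.+ N) σ ≡ run N (run M σ)
  run-+ ℕ.zero    N σ = refl
  run-+ (ℕ.suc M) N σ = run-+ M N (step σ)

  run-halted : ∀ N σ → items σ ≡ [] → run N σ ≡ σ
  run-halted ℕ.zero    σ e = refl
  run-halted (ℕ.suc N) (state t n [] H) refl = run-halted N (state t n [] H) refl

  stable : ∀ M N σ → items (run M σ) ≡ [] → run (M Nat.+ N) σ ≡ run M σ
  stable M N σ e = trans (run-+ M N σ) (run-halted N (run M σ) e)

  -- The two runs may halt after different numbers of steps; both are prolonged to the sum of these,
  -- which leaves halted states unchanged.
  online : (N : Instance → ℕ) → (∀ I → items (run (N I) (initial I)) ≡ []) →
           Online (λ I → pieces (run (N I) (initial I)))
  online N halts I I′ τ eq = begin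
    activeAt (pieces (run (N I) (initial I))) τ                      ≡⟨ cong (λ σ → activeAt (pieces σ) τ) (stable (N I) (N I′) (initial I) (halts I)) ⟨
    activeAt (pieces (run (N I Nat.+ N I′) (initial I))) τ      ≡⟨ sim-active (run-sim (N I Nat.+ N I′) (initial-inv I) (initial-inv I′) (initial-sim eq)) ⟩
    activeAt (pieces (run (N I Nat.+ N I′) (initial I′))) τ     ≡⟨ cong (λ m → activeAt (pieces (run m (initial I′))) τ) (ℕₚ.+-comm (N I) (N I′)) ⟩
    activeAt (pieces (run (N I′ Nat.+ N I) (initial I′))) τ     ≡⟨ cong (λ σ → activeAt (pieces σ) τ) (stable (N I′) (N I) (initial I′) (halts I′)) ⟩
    activeAt (pieces (run (N I′) (initial I′))) τ ∎
    where open ≡-Reasoning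

-- Termination

-- Built directly in lowest terms, so that no normalisation by a gcd blocks computation for a
-- variable `n`.
fromℕ : ℕ → ℚ
fromℕ n = mkℚ (ℤ.+ n) 0 (Coprime.sym (Coprime.1-coprimeTo n))

fromℕ-suc : ∀ n → fromℕ (suc n) ≡ fromℕ n + 1ℚ
fromℕ-suc n = toℚᵘ-injective (ℚᵘₚ.≃-trans (ℚᵘ.*≡* eq) (ℚᵘₚ.≃-sym (toℚᵘ-homo-+ (fromℕ n) 1ℚ)))
  where
  eq : ℤ.+ suc n ℤ.* ℤ.1ℤ ≡ (ℤ.+ n ℤ.* ℤ.1ℤ ℤ.+ ℤ.1ℤ ℤ.* ℤ.1ℤ) ℤ.* ℤ.1ℤ
  eq = cong (ℤ._* ℤ.1ℤ) (trans (cong ℤ.+_ (ℕₚ.+-comm 1 n)) (cong (ℤ._+ ℤ.1ℤ) (sym (ℤₚ.*-identityʳ (ℤ.+ n)))))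

≤-fromℕ : ∀ p → ∃[ n ] (p ≤ fromℕ n)
≤-fromℕ p@(mkℚ a d _) = ℤ.∣ a ∣ , *≤* (ℤₚ.≤-trans (ℤₚ.≤-reflexive (ℤₚ.*-identityʳ a)) (ℤₚ.≤-trans (i≤∣i∣ a)
    (ℤₚ.≤-trans (ℤ.+≤+ (ℕₚ.m≤m*n ℤ.∣ a ∣ (suc d))) (ℤₚ.≤-reflexive (ℤₚ.pos-* ℤ.∣ a ∣ (suc d))))))
  where
  i≤∣i∣ : ∀ i → i ℤ.≤ ℤ.+ ℤ.∣ i ∣
  i≤∣i∣ (ℤ.+ n)      = ℤₚ.≤-refl
  i≤∣i∣ (ℤ.-[1+ n ]) = ℤ.-≤+

archimedean : ∀ p {q} → 0ℚ < q → ∃[ n ] (p ≤ fromℕ n * q)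
archimedean p {q} 0<q = let n , p/q≤n = ≤-fromℕ (p * 1/ q) in
  n , ≤-trans (≤-reflexive (sym (trans (*-assoc p (1/ q) q) (trans (cong (p *_) (*-inverseˡ q)) (*-identityʳ p)))))
              (*-monoʳ-≤-nonNeg q {{nonNegative (<⇒≤ 0<q)}} p/q≤n)
  where
  instance
    q-nonZero : NonZero q
    q-nonZero = pos⇒nonZero q {{positive 0<q}}

total : (Item → ℕ) → List Item → ℕ
total c []       = 0
total c (i ∷ is) = c i Nat.+ total c is

total-mono : ∀ {c c′} is → (∀ {it} → it ∈ is → c′ it ≤ℕ c it) → total c′ is ≤ℕ total c is
total-mono []       h = Nat.z≤n
total-mono (i ∷ is) h = ℕₚ.+-mono-≤ (h (here refl)) (total-mono is (h ∘ there))

total-strict : ∀ {c c′ is it} → (∀ {it} → it ∈ is → c′ it ≤ℕ c it) → it ∈ is → c′ it <ℕ c it →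
  total c′ is <ℕ total c is
total-strict {is = i ∷ is} h (here refl) lt = ℕₚ.+-mono-<-≤ lt (total-mono is (h ∘ there))
total-strict {is = i ∷ is} h (there it∈) lt = ℕₚ.+-mono-≤-< (h (here refl)) (total-strict (h ∘ there) it∈ lt)

onMaybe : {A : Set} → A → (Item → A) → Maybe Item → A
onMaybe z c nothing   = z
onMaybe z c (just it) = c it

total-mapMaybe : ∀ c (f : Item → Maybe Item) is → total c (mapMaybe f is) ≡ total (onMaybe 0 c ∘ f) is
total-mapMaybe c f []       = refl
total-mapMaybe c f (i ∷ is) with f i
... | nothing = total-mapMaybe c f is
... | just j  = cong (c j Nat.+_) (total-mapMaybe c f is)

∑-mapMaybe : ∀ (c : Item → ℚ) (f : Item → Maybe Item) is → ∑ c (mapMaybe f is) ≡ ∑ (onMaybe 0ℚ c ∘ f) is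
∑-mapMaybe c f []       = refl
∑-mapMaybe c f (i ∷ is) with f i
... | nothing = trans (∑-mapMaybe c f is) (sym (+-identityˡ _))
... | just j  = cong (c j +_) (∑-mapMaybe c f is)

∑-drop : ∀ {c c′ : Item → ℚ} {is it d} → (∀ {it} → it ∈ is → c′ it ≤ c it) → it ∈ is → c′ it + d ≤ c it →
  ∑ c′ is + d ≤ ∑ c is
∑-drop {c} {c′} {i ∷ is} {_} {d} h (here refl) lt =
  ≤-trans (≤-reflexive (lemma (c′ i) (∑ c′ is) d)) (+-mono-≤ lt (∑-mono is (h ∘ there)))
  where
  lemma : ∀ a b d → (a + b) + d ≡ (a + d) + b
  lemma = solve-∀ ℚ-ring
∑-drop {c} {c′} {i ∷ is} {_} {d} h (there it∈) lt =
  ≤-trans (≤-reflexive (+-assoc (c′ i) (∑ c′ is) d)) (+-mono-≤ (h (here refl)) (∑-drop (h ∘ there) it∈ lt))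

futureᵈ : {P : Set} → Dec P → ℕ
futureᵈ (yes _) = 0
futureᵈ (no _)  = 1

-- Every step removes a request, makes a request arrive, starts a first
-- transmission for a request (each of these lowers rank), or else lowers the
-- remaining amount of work by a fixed quantity.
rank : ℚ → Item → ℕ
rank t (item J nothing)  = 2 Nat.+ futureᵈ (arr J ≤? t)
rank t (item J (just _)) = 1 Nat.+ futureᵈ (arr J ≤? t)

-- A waiting item counts zero: its start raises this sum, but that step lowers `rank`.
rest : Item → ℚ
rest (item J nothing)        = 0ℚ
rest (item J (just (_ , w))) = w

futureᵈ-mono : ∀ {t t′ a} → t ≤ t′ → futureᵈ (a ≤? t′) ≤ℕ futureᵈ (a ≤? t)
futureᵈ-mono {t} {t′} {a} t≤ with a ≤? t′ | a ≤? t
... | yes _ | _     = Nat.z≤n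
... | no _  | no _  = ℕₚ.≤-refl
... | no ¬p | yes p = contradiction (≤-trans p t≤) ¬p

futureᵈ-arrives : ∀ {t t′ a} → t < a → a ≤ t′ → futureᵈ (a ≤? t′) <ℕ futureᵈ (a ≤? t)
futureᵈ-arrives {t} {t′} {a} t<a a≤ with a ≤? t′ | a ≤? t
... | yes _ | no _  = Nat.s≤s Nat.z≤n
... | no ¬p | _     = contradiction a≤ ¬p
... | yes _ | yes p = ⊥-elim (<-irrefl refl (<-≤-trans t<a p))

rank-mono : ∀ {t t′} it → t ≤ t′ → rank t′ it ≤ℕ rank t it
rank-mono (item J nothing)  t≤ = ℕₚ.+-monoʳ-≤ 2 (futureᵈ-mono {a = arr J} t≤)
rank-mono (item J (just _)) t≤ = ℕₚ.+-monoʳ-≤ 1 (futureᵈ-mono {a = arr J} t≤)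

rank-arrives : ∀ {t t′} it → t < arr (req it) → arr (req it) ≤ t′ → rank t′ it <ℕ rank t it
rank-arrives (item J nothing)  t< a≤ = ℕₚ.+-monoʳ-< 2 (futureᵈ-arrives t< a≤)
rank-arrives (item J (just _)) t< a≤ = ℕₚ.+-monoʳ-< 1 (futureᵈ-arrives t< a≤)

rank-just : ∀ {t t′} it {kw} → t ≤ t′ → rank t′ (item (req it) (just kw)) ≤ℕ rank t it
rank-just (item J nothing)  t≤ = ℕₚ.≤-trans (ℕₚ.+-monoʳ-≤ 1 (futureᵈ-mono {a = arr J} t≤)) (ℕₚ.n≤1+n _)
rank-just (item J (just _)) t≤ = ℕₚ.+-monoʳ-≤ 1 (futureᵈ-mono {a = arr J} t≤)

rank-starts : ∀ {t t′} it {kw} → cur it ≡ nothing → t ≤ t′ → rank t′ (item (req it) (just kw)) <ℕ rank t it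
rank-starts (item J nothing) refl t≤ = ℕₚ.+-monoʳ-≤ 2 (futureᵈ-mono {a = arr J} t≤)

rank-just-arrives : ∀ {t t′} it {kw} → t < arr (req it) → arr (req it) ≤ t′ → rank t′ (item (req it) (just kw)) <ℕ rank t it
rank-just-arrives (item J nothing)  t< a≤ = ℕₚ.<-trans (ℕₚ.+-monoʳ-< 1 (futureᵈ-arrives t< a≤)) (ℕₚ.n<1+n _)
rank-just-arrives (item J (just _)) t< a≤ = ℕₚ.+-monoʳ-< 1 (futureᵈ-arrives t< a≤)

0<rank : ∀ t it → 0 <ℕ rank t it
0<rank t (item J nothing)  = Nat.s≤s Nat.z≤n
0<rank t (item J (just _)) = Nat.s≤s Nat.z≤n

module Termination
  (mode : Mode) (s r ε : ℚ) (ℓ : Lengths) (v : Request → ℚ)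
  (0<s : 0ℚ < s) (0<r : 0ℚ < r) (s*r≡1 : s * r ≡ 1ℚ) (0<ℓ : ∀ p → 0ℚ < ℓ p)
  (short : mode ≡ nonPreemptive → ∀ p q → ℓ p * r ≤ ℓ q)
  (0<ε : 0ℚ < ε) (ε≤1 : ε ≤ 1ℚ) (0≤v : ∀ J → 0ℚ ≤ v J)
  where

  open Onlineness mode s r ε ℓ v 0<s 0<r s*r≡1 0<ℓ short 0<ε ε≤1 0≤v public

  ranks : State → ℕ
  ranks σ = total (rank (now σ)) (items σ)

  rests : State → ℚ
  rests σ = ∑ rest (items σ)

  LongPages : ℚ → State → Set
  LongPages q σ = ∀ {it} → it ∈ items σ → q ≤ ℓ (page (req it))

  module _ (σ : State) (x : Item) (inv : Inv σ) (x∈ : x ∈ items σ) (a≤t : arr (req x) ≤ now σ) where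
    open Inv inv
    open Serve σ x inv x∈ a≤t

    private
      t = now σ
      e = stop σ x
      k = transmission (next σ) x
      w = left σ x
      f = settle t x k w

    rank-settle : ∀ it → onMaybe 0 (rank e) (f it) ≤ℕ rank t it
    rank-settle it with covered? t x it | w ≟ 0ℚ
    ... | yes _ | yes _ = Nat.z≤n
    ... | yes _ | no _  = rank-just it {k , w} (<⇒≤ t<e)
    ... | no _  | _     = rank-mono it (<⇒≤ t<e)

    rank-settle-arrives : ∀ it → t < arr (req it) → arr (req it) ≤ e → onMaybe 0 (rank e) (f it) <ℕ rank t it
    rank-settle-arrives it t<a a≤e with covered? t x it | w ≟ 0ℚ
    ... | yes _ | yes _ = 0<rank t it
    ... | yes _ | no _  = rank-just-arrives it {k , w} t<a a≤e
    ... | no _  | _     = rank-arrives it t<a a≤e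

    ranks-serve : ∀ {it} → it ∈ items σ → onMaybe 0 (rank e) (f it) <ℕ rank t it → ranks (serve σ x) <ℕ ranks σ
    ranks-serve it∈ lt = ℕₚ.≤-<-trans (ℕₚ.≤-reflexive (total-mapMaybe (rank e) f (items σ)))
      (total-strict (λ {it} _ → rank-settle it) it∈ lt)

    ranks-serve-≤ : ranks (serve σ x) ≤ℕ ranks σ
    ranks-serve-≤ = ℕₚ.≤-trans (ℕₚ.≤-reflexive (total-mapMaybe (rank e) f (items σ)))
      (total-mono (items σ) (λ {it} _ → rank-settle it))

    x-covered : Covered t x x
    x-covered = refl , joins (cur x) refl
      where
      joins : ∀ m → cur x ≡ m → Joins t m x
      joins nothing   q = a≤t
      joins (just kw) q = subst (T ∘ is-just) (sym q) tt

    settle-covered : ∀ {it} → Covered t x it → (w ≡ 0ℚ → f it ≡ nothing) × (w ≢ 0ℚ → f it ≡ just (item (req it) (just (k , w))))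
    settle-covered {it} c with covered? t x it | w ≟ 0ℚ
    ... | no ¬c | _     = contradiction c ¬c
    ... | yes _ | yes e = (λ _ → refl) , λ ≢ → contradiction e ≢
    ... | yes _ | no ≢  = (λ e → contradiction e ≢) , λ _ → refl

    -- Covered items share number and page with `x`, and these determine the remaining amount
    -- through `total`.
    running-rest : ∀ {it kw} → cur x ≡ just kw → it ∈ items σ → Covered t x it → rest it ≡ amount x
    running-rest {it} j it∈ c = go (cur x) j refl (proj₂ c)
      where
      go : ∀ m {kw} → m ≡ just kw → cur x ≡ m → Joins t m it → rest it ≡ amount x
      go (just (k₀ , w₀)) refl q jo with is-just-inv (cur it) jo
      ... | (k′ , w′) , q′ with unique x∈ it∈ (proj₁ c) q q′
      ...   | refl = trans (rest-just it q′) (trans (cancel (s * dur (pieces σ) k₀) w′ w₀ (trans (Running.total (running it∈ q′))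
                       (trans (cong ℓ (sym (proj₁ c))) (sym (Running.total (running x∈ q)))))) (sym (amount-just x q)))
        where
        rest-just : ∀ it {k w} → cur it ≡ just (k , w) → rest it ≡ w
        rest-just (item J (just _)) refl = refl
        amount-just : ∀ x {k w} → cur x ≡ just (k , w) → amount x ≡ w
        amount-just (item J (just _)) refl = refl
        cancel : ∀ a b c → a + b ≡ a + c → b ≡ c
        cancel a b c h = trans (undo a b) (trans (cong (_- a) h) (sym (undo a c)))
          where
          undo : ∀ a b → b ≡ (a + b) - a
          undo = solve-∀ ℚ-ring

    left≤amount : w + s * (e - t) ≤ amount x
    left≤amount = ≤-reflexive (lemma (amount x) (s * (e - t)))
      where
      lemma : ∀ a b → (a - b) + b ≡ a
      lemma = solve-∀ ℚ-ring

    rests-serve : ∀ {kw} → cur x ≡ just kw → w ≢ 0ℚ → rests (serve σ x) + s * (e - t) ≤ rests σ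
    rests-serve j w≢0 = ≤-trans (≤-reflexive (cong (_+ s * (e - t)) (∑-mapMaybe rest f (items σ))))
      (∑-drop {c = rest} {c′ = onMaybe 0ℚ rest ∘ f} each x∈ at-x)
      where
      0≤work : 0ℚ ≤ s * (e - t)
      0≤work = 0≤* (<⇒≤ 0<s) (0≤diff (<⇒≤ t<e))
      covered-rest : ∀ {it} → it ∈ items σ → Covered t x it → onMaybe 0ℚ rest (f it) + s * (e - t) ≤ rest it
      covered-rest it∈ c = ≤-trans (≤-reflexive (cong (λ m → onMaybe 0ℚ rest m + s * (e - t)) (proj₂ (settle-covered c) w≢0)))
        (≤-trans left≤amount (≤-reflexive (sym (running-rest j it∈ c))))
      at-x : onMaybe 0ℚ rest (f x) + s * (e - t) ≤ rest x
      at-x = covered-rest x∈ x-covered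
      each : ∀ {it} → it ∈ items σ → onMaybe 0ℚ rest (f it) ≤ rest it
      each {it} it∈ = go (covered? t x it)
        where
        uncovered : ¬ Covered t x it → f it ≡ just it
        uncovered ¬c with covered? t x it
        ... | yes c = contradiction c ¬c
        ... | no _  = refl
        go : Dec (Covered t x it) → onMaybe 0ℚ rest (f it) ≤ rest it
        go (yes c) = ≤-trans (≤-trans (≤-reflexive (sym (+-identityʳ (onMaybe 0ℚ rest (f it))))) (+-monoʳ-≤ (onMaybe 0ℚ rest (f it)) 0≤work)) (covered-rest it∈ c)
        go (no ¬c) = ≤-reflexive (cong (onMaybe 0ℚ rest) (uncovered ¬c))

    serve-progress : ∀ {q} → LongPages q σ → ranks (serve σ x) <ℕ ranks σ ⊎
      (ranks (serve σ x) ≤ℕ ranks σ × rests (serve σ x) + s * q ≤ rests σ)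
    serve-progress {q} long = go (w ≟ 0ℚ) (stopAt-sel mode t (amount x) (items σ)) (cur x) refl
      where
      go : Dec (w ≡ 0ℚ) → e ≡ t + amount x * r ⊎ (∃[ it ] (it ∈ items σ × e ≡ bound t it)) → ∀ m → cur x ≡ m →
           ranks (serve σ x) <ℕ ranks σ ⊎ (ranks (serve σ x) ≤ℕ ranks σ × rests (serve σ x) + s * q ≤ rests σ)
      go (yes w≡0) _ _ _ = inj₁ (ranks-serve x∈
        (subst (_<ℕ rank t x) (sym (cong (onMaybe 0 (rank e)) (proj₁ (settle-covered x-covered) w≡0))) (0<rank t x)))
      -- A step that lasts until completion leaves nothing to send.
      go (no w≢0) (inj₁ full) _ _ = contradiction (trans (cong (λ u → amount x - s * (u - t)) full)
        (trans (cong (λ d → amount x - d) (s*full t (amount x))) (+-inverseʳ (amount x)))) w≢0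
      go (no w≢0) (inj₂ _) nothing q = inj₁ (ranks-serve x∈
        (subst (λ m → onMaybe 0 (rank e) m <ℕ rank t x) (sym (proj₂ (settle-covered x-covered) w≢0)) (rank-starts x {k , w} q (<⇒≤ t<e))))
      go (no w≢0) (inj₂ (it , it∈ , e≡)) (just kw) j with <⊎≥ t (arr (req it))
      ... | inj₁ t<a = inj₁ (ranks-serve it∈ (rank-settle-arrives it t<a
              (≤-reflexive (sym (trans e≡ (bound-future t it t<a))))))
      -- The step lasted for the page length of a pending item, which is at least `q`.
      ... | inj₂ a≤t = inj₂ (ranks-serve-≤ , ≤-trans (+-monoʳ-≤ (rests (serve σ x)) (*-monoˡ (<⇒≤ 0<s)
              (≤-trans (long it∈) (≤-reflexive (sym (trans (cong (_- t) (trans e≡ (bound-arrived t it a≤t))) (lemma t _)))))))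
              (rests-serve j w≢0))
        where
        lemma : ∀ a b → (a + b) - a ≡ b
        lemma = solve-∀ ℚ-ring

  step-progress : ∀ {q} σ → Inv σ → LongPages q σ → items σ ≡ [] ⊎ ranks (step σ) <ℕ ranks σ ⊎
    (ranks (step σ) ≤ℕ ranks σ × rests (step σ) + s * q ≤ rests σ)
  step-progress σ inv long with step σ | step-view σ
  ... | _ | idled none halted = inj₁ refl
  ... | _ | idled none (waited _ ((it , it∈ , refl) , _)) = inj₂ (inj₁ (total-strict
            (λ {j} j∈ → rank-mono j (<⇒≤ (none it∈))) it∈ (rank-arrives it (none it∈) ≤-refl)))
  ... | _ | served x sel = inj₂ (serve-progress σ x inv (Selected.member sel) (Selected.present sel) long)

  step-long : ∀ {q} σ → LongPages q σ → LongPages q (step σ)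
  step-long σ long with step σ | step-view σ
  ... | _ | idled none halted       = long
  ... | _ | idled none (waited _ _) = long
  ... | _ | served x sel = λ it∈ → go (settled σ x it∈)
    where
    go : ∀ {it′} → ∃[ it ] (it ∈ items σ ×
      ((¬ Covered (now σ) x it × it′ ≡ it) ⊎
       (Covered (now σ) x it × left σ x ≢ 0ℚ × it′ ≡ item (req it) (just (transmission (next σ) x , left σ x))))) → _ ≤ ℓ (page (req it′))
    go (it , it∈ , inj₁ (_ , refl))     = long it∈
    go (it , it∈ , inj₂ (_ , _ , refl)) = long it∈

  0≤rests : ∀ σ → Inv σ → 0ℚ ≤ rests σ
  0≤rests σ inv = ∑-nonneg (items σ) λ {it} it∈ → go it it∈
    where
    go : ∀ it → it ∈ items σ → 0ℚ ≤ rest it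
    go (item J nothing)  _   = ≤-refl
    go (item J (just _)) it∈ = <⇒≤ (Running.0<rest (Inv.running inv it∈ refl))

  -- Lexicographic recursion on `m` and `c`. A drop of `ranks` may raise `rests`, so `c` is then
  -- chosen anew by `archimedean`.
  terminates : ∀ {q} → 0ℚ < q → ∀ m c σ → Inv σ → LongPages q σ → ranks σ ≤ℕ m → rests σ ≤ fromℕ c * (s * q) →
    ∃[ N ] (items (run N σ) ≡ [])
  terminates {q} 0<q m c σ inv long r≤ d≤ with step-progress σ inv long
  ... | inj₁ empty = 0 , empty
  terminates {q} 0<q ℕ.zero c σ inv long r≤ d≤ | inj₂ (inj₁ lt) = contradiction (ℕₚ.<-≤-trans lt r≤) λ ()
  terminates {q} 0<q (suc m) c σ inv long r≤ d≤ | inj₂ (inj₁ lt) =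
    let c′ , d≤′ = archimedean (rests (step σ)) (0<* 0<s 0<q)
        N , h = terminates 0<q m c′ (step σ) (step-inv σ inv) (step-long σ long) (ℕₚ.<⇒≤pred (ℕₚ.<-≤-trans lt r≤)) d≤′
    in suc N , h
  terminates {q} 0<q m ℕ.zero σ inv long r≤ d≤ | inj₂ (inj₂ (le , drop)) =
    ⊥-elim (<-irrefl refl (<-≤-trans (0<* 0<s 0<q) (≤-trans (≤-trans (≤-reflexive (sym (+-identityˡ _)))
      (+-monoˡ-≤ (s * q) (0≤rests (step σ) (step-inv σ inv)))) (≤-trans drop (≤-trans d≤ (≤-reflexive (*-zeroˡ (s * q))))))))
  terminates {q} 0<q m (suc c) σ inv long r≤ d≤ | inj₂ (inj₂ (le , drop)) =
    let N , h = terminates 0<q m c (step σ) (step-inv σ inv) (step-long σ long) (ℕₚ.≤-trans le r≤) d≤′ in suc N , h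
    where
    shift : ∀ a b → (a + 1ℚ) * b ≡ a * b + b
    shift = solve-∀ ℚ-ring
    cancel : ∀ a b c → (b + c) - (a + c) ≡ b - a
    cancel = solve-∀ ℚ-ring
    d≤′ : rests (step σ) ≤ fromℕ c * (s * q)
    d≤′ = ≤-diff _ (0≤diff (≤-trans drop (≤-trans d≤ (≤-reflexive (trans (cong (_* (s * q)) (fromℕ-suc c))
            (shift (fromℕ c) (s * q))))))) (cancel (rests (step σ)) (fromℕ c * (s * q)) (s * q))

  shortest : ∀ is → ∃[ q ] (0ℚ < q × (∀ {it} → it ∈ is → q ≤ ℓ (page (req it))))
  shortest []       = 1ℚ , positive⁻¹ 1ℚ , λ ()
  shortest (i ∷ is) with shortest is
  ... | q , 0<q , h with ≤-total q (ℓ (page (req i)))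
  ...   | inj₁ q≤ = q , 0<q , λ { (here refl) → q≤ ; (there it∈) → h it∈ }
  ...   | inj₂ ≤q = ℓ (page (req i)) , 0<ℓ _ , λ { (here refl) → ≤-refl ; (there it∈) → ≤-trans ≤q (h it∈) }

  halting : ∀ I → ∃[ N ] (items (run N (initial I)) ≡ [])
  halting I =
    let q , 0<q , long = shortest (items (initial I))
        c , d≤ = archimedean (rests (initial I)) (0<* 0<s 0<q)
    in terminates 0<q (ranks (initial I)) c (initial I) (initial-inv I) long ℕₚ.≤-refl d≤

  algorithm : Algorithm
  algorithm I = pieces (run (proj₁ (halting I)) (initial I))

  algorithm-online : Online algorithm
  algorithm-online = online (proj₁ ∘ halting) (proj₂ ∘ halting)

-- The three objectives as weighted response times.

slack-positive : ∀ J → arr J < dl J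
slack-positive record { arr = a ; dl = d ; slack-pos = a<d } = recompute (a <? d) a<d

-- Deciding the inequality again turns the irrelevant field into a usable proof, as for the slack.
wt-nonnegative : ∀ J → 0ℚ ≤ wt J
wt-nonnegative record { wt = w ; wt-nonneg = 0≤w } = recompute (0ℚ ≤? w) 0≤w

1/slack : Request → ℚ
1/slack J = (1/ slack J) {{slack-nonZero J}}

0≤1/slack : ∀ J → 0ℚ ≤ 1/slack J
0≤1/slack J = <⇒≤ (positive⁻¹ (1/slack J) {{1/pos⇒pos (slack J) {{positive (0<q-p (slack-positive J))}}}})

-- Up to lower-order terms every objective is a weighted response time.
urgency : Objective → Request → ℚ
urgency delayFactor         J = 1/slack J
urgency weightedResponse    J = wt J
urgency weightedDelayFactor J = wt J * 1/slack J

0≤urgency : ∀ obj J → 0ℚ ≤ urgency obj J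
0≤urgency delayFactor         J = 0≤1/slack J
0≤urgency weightedResponse    J = wt-nonnegative J
0≤urgency weightedDelayFactor J = 0≤* (wt-nonnegative J) (0≤1/slack J)

urgency≤cost : ∀ obj J f → urgency obj J * (f - arr J) ≤ cost obj J f
urgency≤cost delayFactor         J f = ≤-trans (≤-reflexive (*-comm (1/slack J) (f - arr J))) (p≤q⊔p 1ℚ _)
urgency≤cost weightedResponse    J f = ≤-refl
urgency≤cost weightedDelayFactor J f = ≤-trans
  (≤-reflexive (trans (*-assoc (wt J) (1/slack J) (f - arr J)) (cong (wt J *_) (*-comm (1/slack J) (f - arr J)))))
  (*-monoˡ (wt-nonnegative J) (p≤q⊔p 1ℚ _))

*-⊔-≤ : ∀ e p q {b} → e * p ≤ b → e * q ≤ b → e * (p ⊔ q) ≤ b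
*-⊔-≤ e p q {b} hp hq with ⊔-sel p q
... | inj₁ eq = subst (λ x → e * x ≤ b) (sym eq) hp
... | inj₂ eq = subst (λ x → e * x ≤ b) (sym eq) hq

module _ {c : ℚ} (0≤c : 0ℚ ≤ c) (c≤1 : c ≤ 1ℚ) where

  -- The maximum with 1 does no harm: the offline cost contains the same 1, or weight times 1, and
  -- is at most `B`.
  scaled-cost : ∀ obj J f₀ f {B K} → B ≤ K → cost obj J f₀ ≤ B →
    c * (urgency obj J * (f - arr J)) ≤ K → c * cost obj J f ≤ K
  scaled-cost delayFactor J f₀ f B≤K opt h = *-⊔-≤ c 1ℚ ((f - arr J) * 1/slack J)
    (≤-trans (scale≤ 0≤c c≤1 0≤1ℚ) (≤-trans (p≤p⊔q 1ℚ ((f₀ - arr J) * 1/slack J)) (≤-trans opt B≤K)))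
    (≤-trans (≤-reflexive (cong (c *_) (*-comm (f - arr J) (1/slack J)))) h)
  scaled-cost weightedResponse J f₀ f B≤K opt h = h
  scaled-cost weightedDelayFactor J f₀ f {B} {K} B≤K opt h =
    ≤-trans (≤-reflexive (sym (*-assoc c (wt J) (1ℚ ⊔ (f - arr J) * 1/slack J))))
      (*-⊔-≤ (c * wt J) 1ℚ ((f - arr J) * 1/slack J)
        (≤-trans (≤-reflexive (*-assoc c (wt J) 1ℚ)) (≤-trans (scale≤ 0≤c c≤1 (0≤* (wt-nonnegative J) 0≤1ℚ))
          (≤-trans (*-monoˡ (wt-nonnegative J) (p≤p⊔q 1ℚ ((f₀ - arr J) * 1/slack J))) (≤-trans opt B≤K))))
        (≤-trans (≤-reflexive (lemma c (wt J) (f - arr J) (1/slack J))) h))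
    where
    lemma : ∀ c w d i → (c * w) * (d * i) ≡ c * ((w * i) * d)
    lemma = solve-∀ ℚ-ring

allowed-valid : ∀ m {s ℓ S} → Allowed m s ℓ S → Valid s ℓ S
allowed-valid nonPreemptive (valid , _) = valid
allowed-valid preemptive    valid       = valid

module Competitiveness
  (mode : Mode) (obj : Objective) (s r ε : ℚ) (ℓ : Lengths)
  (0<s : 0ℚ < s) (0<r : 0ℚ < r) (s*r≡1 : s * r ≡ 1ℚ) (0<ℓ : ∀ p → 0ℚ < ℓ p)
  (short : mode ≡ nonPreemptive → ∀ p q → ℓ p * r ≤ ℓ q)
  (0<ε : 0ℚ < ε) (ε≤1 : ε ≤ 1ℚ)
  (speed-np : mode ≡ nonPreemptive → s ≡ 1ℚ + ε) (speed-pr : mode ≡ preemptive → s ≡ (1ℚ + 1ℚ) + ε)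
  where

  v : Request → ℚ
  v = urgency obj

  open Termination mode s r ε ℓ v 0<s 0<r s*r≡1 0<ℓ short 0<ε ε≤1 (0≤urgency obj) public

  allowed : ∀ m → mode ≡ m → ∀ {σ} → Inv σ → Allowed m s ℓ (pieces σ)
  allowed m eq {σ} inv = go m eq
    where
    open Inv inv
    valid : Valid s ℓ (pieces σ)
    valid = proper , disj , same , capped
    go : ∀ m → mode ≡ m → Allowed m s ℓ (pieces σ)
    go nonPreemptive eq = valid , proj₂ (whole eq)
    go preemptive    eq = valid

  competitive : Competitive mode obj s ℓ (6ℚ * 6ℚ) ε algorithm
  competitive I = allowed mode refl (run-inv (proj₁ (halting I)) (initial I) (initial-inv I)) , against
    where
    against : ∀ B S → Allowed mode 1ℚ ℓ S → ObjAtMost obj 1ℚ ℓ I S B →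
      ∀ {J} → J ∈ I → ∃[ f ] (FinishedBy s ℓ (algorithm I) J f × ε * ε * cost obj J f ≤ 6ℚ * 6ℚ * B)
    against B S ok atMost {J} J∈ = bounded (run-met (proj₁ (halting I)) (initial I) (initial-good I opt) (initial-met I J∈))
      where
      open Analysis mode s r ε ℓ v 0<s 0<r s*r≡1 0<ℓ short 0<ε ε≤1 (0≤urgency obj) speed-np speed-pr
        S B (proj₁ (allowed-valid mode ok)) (proj₁ (proj₂ (allowed-valid mode ok)))
        using (Opt; Met; D; initial-good; initial-met; run-met)
      opt : ∀ {J} → J ∈ I → Opt J
      opt {J} J∈ with atMost J∈
      ... | f , (k , full , sat) , c≤B = record
        { oid     = k
        ; fin     = f
        ; oid-dur = trans (sym (*-identityˡ _)) full
        ; oid-ok  = sat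
        ; fin≤B   = ≤-trans (urgency≤cost obj J f) c≤B
        }
      0≤B : 0ℚ ≤ B
      0≤B = Opt.0≤B (opt J∈)
      B≤ : B ≤ 6ℚ * 6ℚ * B
      B≤ = ≤-trans (≤-reflexive (sym (*-identityˡ B))) (*-monoʳ-≤-nonNeg B {{nonNegative 0≤B}} 1≤36)
        where
        1≤36 : 1ℚ ≤ 6ℚ * 6ℚ
        1≤36 = ≤ᵇ⇒≤ tt
      ε²≤1 : ε * ε ≤ 1ℚ
      ε²≤1 = ≤-trans (scale≤ 0≤ε ε≤1 0≤ε) ε≤1
      bounded : Met (run (proj₁ (halting I)) (initial I)) J →
        ∃[ f ] (FinishedBy s ℓ (algorithm I) J f × ε * ε * cost obj J f ≤ 6ℚ * 6ℚ * B)
      -- The halted run has no pending request left.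
      bounded (inj₁ (it , it∈ , _)) = contradiction (subst (it ∈_) (proj₂ (halting I)) it∈) λ ()
      bounded (inj₂ (f , fin , h)) = f , fin , scaled-cost (0≤* 0≤ε 0≤ε) ε²≤1 obj J (proj₁ (atMost J∈)) f B≤
        (proj₂ (proj₂ (atMost J∈)))
        (≤-trans (≤-reflexive (*-assoc ε ε _)) (≤-trans h (≤-reflexive (sym (*-assoc 6ℚ 6ℚ B)))))

0<36 : 0ℚ < 6ℚ * 6ℚ
0<36 = positive⁻¹ (6ℚ * 6ℚ)

module _ {s : ℚ} (0<s : 0ℚ < s) where

  private
    instance
      s-nonZero : NonZero s
      s-nonZero = pos⇒nonZero s {{positive 0<s}}

  inverse : ∃[ r ] (0ℚ < r × s * r ≡ 1ℚ)
  inverse = 1/ s , positive⁻¹ (1/ s) {{1/pos⇒pos s {{positive 0<s}}}} , *-inverseʳ s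

theorem2 : (obj : Objective) →
    (∃[ C ] (0ℚ < C × (∀ (ε : ℚ) → 0ℚ < ε → ε ≤ 1ℚ → ∀ (ℓ : Lengths) → UnitLengths ℓ →
    ∃[ A ] (Online A × Competitive nonPreemptive obj (1ℚ + ε) ℓ C ε A))))
    × (∃[ C ] (0ℚ < C × (∀ (ε : ℚ) → 0ℚ < ε → ε ≤ 1ℚ → ∀ (ℓ : Lengths) → PositiveLengths ℓ →
    ∃[ A ] (Online A × Competitive preemptive obj ((1ℚ + 1ℚ) + ε) ℓ C ε A))))
theorem2 obj = (6ℚ * 6ℚ , 0<36 , unit) , (6ℚ * 6ℚ , 0<36 , general)
  where
  0<1+ : ∀ {p ε} → 0ℚ ≤ p → 0ℚ < ε → 0ℚ < p + ε
  0<1+ 0≤p 0<ε = +-mono-≤-< 0≤p 0<ε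

  unit : ∀ (ε : ℚ) → 0ℚ < ε → ε ≤ 1ℚ → ∀ (ℓ : Lengths) → UnitLengths ℓ →
    ∃[ A ] (Online A × Competitive nonPreemptive obj (1ℚ + ε) ℓ (6ℚ * 6ℚ) ε A)
  unit ε 0<ε ε≤1 ℓ ℓ≡1 with inverse {1ℚ + ε} (0<1+ 0≤1ℚ 0<ε)
  ... | r , 0<r , s*r≡1 = algorithm , algorithm-online , competitive
    where
    0<s : 0ℚ < 1ℚ + ε
    0<s = 0<1+ 0≤1ℚ 0<ε
    0<ℓ : ∀ p → 0ℚ < ℓ p
    0<ℓ p = subst (0ℚ <_) (sym (ℓ≡1 p)) (positive⁻¹ 1ℚ)
    r≤1 : r ≤ 1ℚ
    r≤1 = ≤-diff (ε * r) (0≤* (<⇒≤ 0<ε) (<⇒≤ 0<r)) (trans (lemma ε r) (cong (_- r) s*r≡1))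
      where
      lemma : ∀ e r → e * r ≡ (1ℚ + e) * r - r
      lemma = solve-∀ ℚ-ring
    -- At speed above 1 a unit page takes time `r` ≤ 1, and 1 is the length of every page.
    short : nonPreemptive ≡ nonPreemptive → ∀ p q → ℓ p * r ≤ ℓ q
    short _ p q = subst₂ (λ a b → a * r ≤ b) (sym (ℓ≡1 p)) (sym (ℓ≡1 q)) (≤-trans (≤-reflexive (*-identityˡ r)) r≤1)
    open Competitiveness nonPreemptive obj (1ℚ + ε) r ε ℓ 0<s 0<r s*r≡1 0<ℓ short 0<ε ε≤1 (λ _ → refl) (λ ())
      using (algorithm; algorithm-online; competitive)

  general : ∀ (ε : ℚ) → 0ℚ < ε → ε ≤ 1ℚ → ∀ (ℓ : Lengths) → PositiveLengths ℓ →
    ∃[ A ] (Online A × Competitive preemptive obj ((1ℚ + 1ℚ) + ε) ℓ (6ℚ * 6ℚ) ε A)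
  general ε 0<ε ε≤1 ℓ 0<ℓ with inverse {(1ℚ + 1ℚ) + ε} (0<1+ (0≤+ 0≤1ℚ 0≤1ℚ) 0<ε)
  ... | r , 0<r , s*r≡1 = algorithm , algorithm-online , competitive
    where
    0<s : 0ℚ < (1ℚ + 1ℚ) + ε
    0<s = 0<1+ (0≤+ 0≤1ℚ 0≤1ℚ) 0<ε
    open Competitiveness preemptive obj ((1ℚ + 1ℚ) + ε) r ε ℓ 0<s 0<r s*r≡1 0<ℓ (λ ()) 0<ε ε≤1 (λ ()) (λ _ → refl)
      using (algorithm; algorithm-online; competitive)
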